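{- Let $P^n$ be an $n$-dimensional polytope. Then $$F(l_\alpha(P^n))=f(P^n)^*.$$
   Context: A combinatorial polytope is a combinatorial equivalence class of convex polytopes; $\mathcal{P}$ is the ring of polytopes: the free abelian group on (non-empty) combinatorial polytopes with multiplication the direct product and unit the point. A finite poset with minimal element $\hat0$ and maximal element $\hat1$ is graded if it has a rank function $\rho$ with $\rho(\hat0)=0$ and $\rho(y)=\rho(x)+1$ whenever $y$ covers $x$; write $\rho(x,y)=\rho(y)-\rho(x)$. $\mathcal{R}$ is the Rota–Hopf algebra (over $\mathbb{Z}$): the free module on isomorphism classes of finite graded posets with multiplication the cartesian product and unit the one-element poset. The linear map $l_\alpha:\mathcal{P}\to\mathcal{R}[\alpha]$ (a ring homomorphism) is $l_\alpha(P)=\sum_{F\subseteq P}\alpha^{\dim F}[F,P]$, the sum over all non-empty faces $F$ of $P$ (including $P$), where $[F,P]$ is the interval in the face lattice of $P$. For a composition $\omega=(j_1,\dots,j_k)$, $j_i\ge1$, $M_\omega=\sum_{l_1<\dots<l_k}t_{l_1}^{j_1}\cdots t_{l_k}^{j_k}$; $\mathrm{Qsym}[t_1,t_2,\dots]$ is the ring of finite integer combinations of the $M_\omega$ (and constants). The Ehrenborg quasi-symmetric function of a graded poset is $F(P)=\sum_{\hat0=x_0<x_1<\dots<x_{k+1}=\hat1}M_{(\rho(x_0,x_1),\rho(x_1,x_2),\dots,\rho(x_k,x_{k+1}))}$ (sum over all chains from $\hat0$ to $\hat1$; $F=1$ on the one-element poset); it is extended linearly, with $F(\alpha)=\alpha$,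 to a ring homomorphism $F:\mathcal{R}[\alpha]\to\mathrm{Qsym}[t_1,t_2,\dots][\alpha]$. The involution $*$ on $\mathrm{Qsym}[t_1,t_2,\dots][\alpha]$ is $\mathbb{Z}[\alpha]$-linear with $M_{(j_1,\dots,j_k)}^*=M_{(j_k,\dots,j_1)}$. The generalized $f$-polynomial is $$f(P^n)=\alpha^n+\sum_{k=1}^{n}\ \sum_{0\leqslant a_1<\dots<a_k\leqslant n-1}f_{a_1,\dots,a_k}\,\alpha^{a_1}M_{(n-a_k,\,a_k-a_{k-1},\dots,\,a_2-a_1)},$$ where $f_{a_1,\dots,a_k}$ is the number of chains of faces $F^{a_1}\subset\dots\subset F^{a_k}$ of $P^n$ with $\dim F^{a_i}=a_i$. -}

module Defs where

open import Algebra.Bundles using (CommutativeRing)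
import Algebra.Properties.CommutativeMonoid.Sum as CommutativeMonoidSum
import Algebra.Properties.Ring as RingProperties
import Algebra.Properties.Semiring.Sum as SemiringSum
open import Axiom.ExcludedMiddle using (ExcludedMiddle)
open import Data.Bool.Base using (Bool; true; false; if_then_else_)
open import Data.Empty using (⊥-elim)
open import Data.Fin.Base using (Fin; zero; suc; punchIn; punchOut)
open import Data.Fin.Properties using (punchIn-punchOut) renaming (_≟_ to _≟ᶠ_)
open import Data.Integer.Base as ℤ using (ℤ; 0ℤ; 1ℤ)
open import Data.List.Base
  using (List; []; _∷_; _++_; map; concatMap; cartesianProductWith; length; reverse; upTo)
open import Data.List.Membership.Propositional using (_∈_)
open import Data.List.Membership.Propositional.Properties using (∈-cartesianProductWith⁺)
open import Data.List.Relation.Unary.All as All using (All; []; _∷_)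
import Data.List.Relation.Unary.All.Properties as All
open import Data.List.Relation.Unary.AllPairs as AllPairs using (AllPairs; []; _∷_)
import Data.List.Relation.Unary.AllPairs.Properties as AllPairs
open import Data.List.Relation.Unary.Any as Any using (Any; here; there)
import Data.List.Relation.Unary.Any.Properties as Any
open import Data.List.Relation.Unary.Enumerates.Setoid using (IsEnumeration)
open import Data.List.Relation.Unary.Linked as Linked using (Linked; []; [-]; _∷_)
import Data.List.Relation.Unary.Linked.Properties as Linked
open import Data.List.Relation.Unary.Unique.Propositional using () renaming (Unique to Unique≡)
import Data.List.Relation.Unary.Unique.Propositional.Properties as Unique≡
open import Data.List.Relation.Unary.Unique.Setoid using (Unique)
open import Data.Nat.Base as ℕ using (ℕ; zero; suc; pred; NonZero; _∸_)
import Data.Nat.Properties as ℕ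
open import Data.Product using (Σ; Σ-syntax; ∃; ∃-syntax; _×_; _,_; proj₁; proj₂; map₁)
open import Data.Sum.Base using (_⊎_; inj₁; inj₂)
open import Data.Vec.Base as Vec using (Vec; toList)
open import Data.Vec.Functional using (Vector)
import Data.Vec.Properties as Vec
open import Function.Base using (_∘_; id; _on_)
open import Function.Bundles using (_⇔_; mk⇔; Equivalence)
open import Level using (0ℓ)
open import Relation.Binary.Bundles using (Poset; Setoid)
open import Relation.Binary.Core using (Rel)
open import Relation.Binary.Definitions using (Minimum; Maximum)
import Relation.Binary.Construct.NonStrictToStrict as NonStrictToStrict
import Relation.Binary.Reasoning.Setoid as SetoidReasoning
open import Relation.Binary.PropositionalEquality
  using (_≡_; _≢_; refl; sym; trans; cong; subst)
open import Relation.Binary.Structures using (IsTotalOrder)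
open import Relation.Nullary.Decidable.Core using (Dec; yes; no; does; decidable-stable)
open import Relation.Nullary.Negation using (¬_; contradiction)
open import Relation.Unary using (Decidable)

select : ∀ {a q} {A : Set a} {Q : A → Set q} → Decidable Q → List A → List (Σ A Q)
select Q? []       = []
select Q? (x ∷ xs) with Q? x
... | yes q = (x , q) ∷ select Q? xs
... | no  _ = select Q? xs

tuples : ∀ {a} {A : Set a} (k : ℕ) → List A → List (Vec A k)
tuples zero    xs = Vec.[] ∷ []
tuples (suc k) xs = cartesianProductWith Vec._∷_ xs (tuples k xs)

select-All : ∀ {a q r} {A : Set a} {Q : A → Set q} {R : A → Set r} (Q? : Decidable Q) {xs} →
             All R xs → All (R ∘ proj₁) (select Q? xs)
select-All Q? []             = []
select-All Q? {x ∷ _} (r ∷ rs) with Q? x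
... | yes _ = r ∷ select-All Q? rs
... | no  _ = select-All Q? rs

select-AllPairs : ∀ {a q r} {A : Set a} {Q : A → Set q} {R : Rel A r} (Q? : Decidable Q) {xs} →
                  AllPairs R xs → AllPairs (R on proj₁) (select Q? xs)
select-AllPairs Q? []             = []
select-AllPairs Q? {x ∷ _} (r ∷ rs) with Q? x
... | yes _ = select-All Q? r ∷ select-AllPairs Q? rs
... | no  _ = select-AllPairs Q? rs

select-Any : ∀ {a q r} {A : Set a} {Q : A → Set q} {R : A → Set r} (Q? : Decidable Q) {xs} →
             (∀ {x} → R x → Q x) → Any R xs → Any (R ∘ proj₁) (select Q? xs)
select-Any Q? {x ∷ _} f (here r) with Q? x
... | yes _ = here r
... | no ¬q = contradiction (f r) ¬q
select-Any Q? {x ∷ _} f (there rs) with Q? x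
... | yes _ = there (select-Any Q? f rs)
... | no  _ = select-Any Q? f rs

tuples-complete : ∀ {a} {A : Set a} {xs : List A} → (∀ x → x ∈ xs) →
                  ∀ {k} (t : Vec A k) → t ∈ tuples k xs
tuples-complete c Vec.[]      = here refl
tuples-complete c (x Vec.∷ t) = ∈-cartesianProductWith⁺ Vec._∷_ (c x) (tuples-complete c t)

tuples-unique : ∀ {a} {A : Set a} {xs : List A} → Unique≡ xs → ∀ k → Unique≡ (tuples k xs)
tuples-unique u zero    = [] ∷ []
tuples-unique u (suc k) =
  Unique≡.cartesianProductWith⁺ Vec._∷_ Vec.∷-injective u (tuples-unique u k)

-- Free ℤ-modules: an element is presented as a list of terms c · a, and
-- two presentations are only ever compared through their coefficients.

FreeModule : ∀ {a} → Set a → Set a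
FreeModule A = List (ℤ × A)

gen : ∀ {a} {A : Set a} → A → FreeModule A
gen x = (1ℤ , x) ∷ []

infixr 7 _⊙_
_⊙_ : ∀ {a} {A : Set a} → ℤ → FreeModule A → FreeModule A
c ⊙ q = map (map₁ (c ℤ.*_)) q

∑-syntax : ∀ {a b} {A : Set a} {B : Set b} → List B → (B → FreeModule A) → FreeModule A
∑-syntax xs f = concatMap f xs

infix 5 ∑-syntax
syntax ∑-syntax xs (λ x → e) = ∑[ x ← xs ] e

linear : ∀ {a b} {A : Set a} {B : Set b} → (A → FreeModule B) → FreeModule A → FreeModule B
linear g q = ∑[ t ← q ] proj₁ t ⊙ g (proj₂ t)

record Composition : Set where
  constructor composition
  field
    parts     : List ℕ
    .positive : All NonZero parts

open Composition

ε : Composition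
ε = composition [] []

rev : Composition → Composition
rev (composition xs ps) = composition (reverse xs) (reverse⁺ ps)
  where
  reverse⁺ : ∀ {xs} → All NonZero xs → All NonZero (reverse xs)
  reverse⁺ {xs} ps = All.tabulate (λ x∈ → All.lookup ps (Any.reverse⁻ x∈))

differences : List ℕ → List ℕ
differences []           = []
differences (x ∷ [])     = []
differences (x ∷ y ∷ xs) = (y ∸ x) ∷ differences (y ∷ xs)

gaps : ∀ {xs} → Linked ℕ._<_ xs → Composition
gaps {xs} xs↗ = composition (differences xs) (nonZero xs↗)
  where
  nonZero : ∀ {xs} → Linked ℕ._<_ xs → All NonZero (differences xs)
  nonZero []           = []
  nonZero [-]          = []
  nonZero (x<y ∷ xs↗) = ℕ.>-nonZero (ℕ.m<n⇒0<n∸m x<y) ∷ nonZero xs↗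

QSym : Set
QSym = FreeModule Composition

-- The generator (k , ω) stands for α ^ k M_ω.
QSym[α] : Set
QSym[α] = FreeModule (ℕ × Composition)

α^_·_ : ℕ → QSym → QSym[α]
α^ k · q = linear (λ ω → gen (k , ω)) q

-- The coefficient of t₁^e₁ t₂^e₂ ⋯ tₛ^eₛ in M_ω (t₁ , t₂ , …), by
-- M_(j,ω) (t₁ , t₂ , …) = t₁^j M_ω (t₂ , t₃ , …) + M_(j,ω) (t₂ , t₃ , …),
-- where the first summand collects the terms with l₁ = 1.
coeffM : List ℕ → List ℕ → ℤ
coeffM []      []      = 1ℤ
coeffM (j ∷ ω) []      = 0ℤ
coeffM []      (e ∷ m) = if e ℕ.≡ᵇ 0 then coeffM [] m else 0ℤ
coeffM (j ∷ ω) (e ∷ m) =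
  (if e ℕ.≡ᵇ j then coeffM ω m else 0ℤ) ℤ.+ (if e ℕ.≡ᵇ 0 then coeffM (j ∷ ω) m else 0ℤ)

-- The coefficient of α ^ k t₁^e₁ ⋯ tₛ^eₛ.
coeff : QSym[α] → ℕ → List ℕ → ℤ
coeff []                k m = 0ℤ
coeff ((c , i , ω) ∷ q) k m = c ℤ.* (if i ℕ.≡ᵇ k then coeffM (parts ω) m else 0ℤ) ℤ.+ coeff q k m

infix 4 _≈Q_
_≈Q_ : QSym[α] → QSym[α] → Set
p ≈Q q = ∀ k m → coeff p k m ≡ coeff q k m

infix 8 _⋆
_⋆ : QSym[α] → QSym[α]
_⋆ = linear (λ t → gen (proj₁ t , rev (proj₂ t)))

record GradedPoset : Set₁ where
  field
    poset : Poset 0ℓ 0ℓ 0ℓ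

  open Poset poset using (Carrier; _≈_; _≤_; antisym; module Eq) renaming (trans to ≤-trans) public
  open NonStrictToStrict _≈_ _≤_ using (_<_) public

  _Covers_ : Carrier → Carrier → Set
  y Covers x = x < y × (∀ z → ¬ (x < z × z < y))

  field
    elements          : List Carrier
    elements-complete : IsEnumeration Eq.setoid elements
    elements-unique   : Unique Eq.setoid elements
    0̂ 1̂               : Carrier
    0̂-minimum         : Minimum _≤_ 0̂
    1̂-maximum         : Maximum _≤_ 1̂
    ρ                 : Carrier → ℕ
    ρ-cong            : ∀ {x y} → x ≈ y → ρ x ≡ ρ y
    ρ-0̂               : ρ 0̂ ≡ 0
    ρ-covers          : ∀ {x y} → y Covers x → ρ y ≡ suc (ρ x)

-- The Rota–Hopf algebra with α adjoined; (k , Q) stands for α ^ k Q.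
-- Generators are posets rather than isomorphism classes, which is harmless
-- because the map F below takes equal values on isomorphic posets.
𝓡[α] : Set₁
𝓡[α] = FreeModule (ℕ × GradedPoset)

module Ehrenborg (em : ExcludedMiddle 0ℓ) where

  module _ (Q : GradedPoset) where
    open GradedPoset Q

    ρ-strict-aux : ∀ xs {x y} → x < y → (∀ z → x < z → z < y → Any (z ≈_) xs) → ρ x ℕ.< ρ y
    ρ-strict-aux [] x<y between =
      ℕ.≤-reflexive (sym (ρ-covers (x<y , λ { z (x<z , z<y) → contradiction (between z x<z z<y) λ () })))
    ρ-strict-aux (w ∷ ws) {x} {y} x<y between with em {x < w × w < y}
    ... | yes (x<w , w<y) = ℕ.<-trans
      (ρ-strict-aux ws x<w λ z x<z z<w →
        drop z (proj₂ z<w) (between z x<z (<-trans z<w w<y)))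
      (ρ-strict-aux ws w<y λ z w<z z<y →
        drop z (λ e → proj₂ w<z (Eq.sym e)) (between z (<-trans x<w w<z) z<y))
      where
      open NonStrictToStrict _≈_ _≤_ using () renaming (<-trans to <-trans′)
      <-trans = λ {i} {j} {k} → <-trans′ (Poset.isPartialOrder poset) {i} {j} {k}
      drop : ∀ z → ¬ z ≈ w → Any (z ≈_) (w ∷ ws) → Any (z ≈_) ws
      drop z z≉w (here e)  = contradiction e z≉w
      drop z z≉w (there e) = e
    ... | no ¬between = ρ-strict-aux ws x<y λ z x<z z<y → drop x<z z<y (between z x<z z<y)
      where
      resp = Poset.≤-respʳ-≈ poset
      drop : ∀ {z} → x < z → z < y → Any (z ≈_) (w ∷ ws) → Any (z ≈_) ws
      drop x<z z<y (there e) = e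
      drop (x≤z , x≉z) (z≤y , z≉y) (here e) = contradiction
        ( (resp e x≤z , λ x≈w → x≉z (Eq.trans x≈w (Eq.sym e)))
        , (Poset.≤-respˡ-≈ poset e z≤y , λ w≈y → z≉y (Eq.trans e w≈y))) ¬between

    ρ-strict : ∀ {x y} → x < y → ρ x ℕ.< ρ y
    ρ-strict x<y = ρ-strict-aux elements x<y λ z _ _ → elements-complete z

    -- A chain 0̂ = x₀ < x₁ < … < xₖ < xₖ₊₁ = 1̂ is given by (x₁ , … , xₖ).
    IsChain : ∀ {k} → Vec Carrier k → Set
    IsChain t = Linked _<_ (0̂ ∷ toList t ++ 1̂ ∷ [])

    chains : (k : ℕ) → List (Σ (Vec Carrier k) IsChain)
    chains k = select (λ _ → em) (tuples k elements)

    chainType : ∀ {k} → Σ (Vec Carrier k) IsChain → Composition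
    chainType (_ , c) = gaps (Linked.map⁺ (Linked.map ρ-strict c))

    -- A chain with k intermediate elements needs k < length elements.
    F₀ : QSym
    F₀ with em {0̂ ≈ 1̂}
    ... | yes _ = gen ε
    ... | no  _ = ∑[ k ← upTo (length elements) ] ∑[ c ← chains k ] gen (chainType c)

  F : 𝓡[α] → QSym[α]
  F = linear (λ t → α^ proj₁ t · F₀ (proj₂ t))

-- The real numbers, axiomatised as a complete ordered field.  Equality is
-- a setoid equality, so that Dedekind cuts are an instance.

record CompleteOrderedField : Set₁ where
  field
    commutativeRing : CommutativeRing 0ℓ 0ℓ

  open CommutativeRing commutativeRing hiding (zero) public

  infix 4 _≤_
  field
    _≤_          : Rel Carrier 0ℓ
    isTotalOrder : IsTotalOrder _≈_ _≤_
    1≉0          : ¬ 1# ≈ 0#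
    inverse      : ∀ x → ¬ x ≈ 0# → ∃[ y ] x * y ≈ 1#
    +-monoˡ-≤    : ∀ {x y} z → x ≤ y → x + z ≤ y + z
    *-nonNeg     : ∀ {x y} → 0# ≤ x → 0# ≤ y → 0# ≤ x * y

  UpperBound : (Carrier → Set) → Carrier → Set
  UpperBound S b = ∀ x → S x → x ≤ b

  field
    supremum : (S : Carrier → Set) → ∃ S → ∃ (UpperBound S) →
               ∃[ s ] UpperBound S s × (∀ b → UpperBound S b → s ≤ b)

module LinearAlgebra (em : ExcludedMiddle 0ℓ) (ℝ : CompleteOrderedField) where

  open CompleteOrderedField ℝ
    renaming (refl to ≈-refl; sym to ≈-sym; trans to ≈-trans; reflexive to ≈-reflexive)
  open CommutativeMonoidSum +-commutativeMonoid using (sum; sum-cong-≋; ∑-distrib-+; ∑-comm)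
  open SemiringSum semiring using (*-distribˡ-sum; *-distribʳ-sum)
  open RingProperties ring using (-‿distribˡ-*; -‿distribʳ-*; -0#≈0#; -‿involutive)
  open SetoidReasoning setoid
  module ≤ = IsTotalOrder isTotalOrder

  ≈-stable : ∀ {x y} → ¬ ¬ x ≈ y → x ≈ y
  ≈-stable = decidable-stable em

  infix 8 _·_
  _·_ : ∀ {n} → Vector Carrier n → Vector Carrier n → Carrier
  x · a = sum (λ j → x j * a j)

  cancel₁ : ∀ a b → (a + - b) + b ≈ a
  cancel₁ a b = ≈-trans (+-assoc a (- b) b) (≈-trans (+-congˡ (-‿inverseˡ b)) (+-identityʳ a))

  cancel₂ : ∀ a b → (a + b) + - b ≈ a
  cancel₂ a b = ≈-trans (+-assoc a b (- b)) (≈-trans (+-congˡ (-‿inverseʳ b)) (+-identityʳ a))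

  sum-zero : ∀ {n} {f : Vector Carrier n} → (∀ i → f i ≈ 0#) → sum f ≈ 0#
  sum-zero {zero}  f≈0 = ≈-refl
  sum-zero {suc n} f≈0 = ≈-trans (+-cong (f≈0 zero) (sum-zero (f≈0 ∘ suc))) (+-identityˡ 0#)

  sum-lin : ∀ {n} (f g : Vector Carrier n) t → sum (λ i → f i + t * g i) ≈ sum f + t * sum g
  sum-lin f g t = ≈-trans (∑-distrib-+ f (λ i → t * g i)) (+-congˡ (≈-sym (*-distribˡ-sum t g)))

  sum-swap : ∀ {m n} (w : Vector Carrier m) (A : Fin m → Vector Carrier n) (s : Vector Carrier n) →
             (λ j → sum (λ i → w i * A i j)) · s ≈ sum (λ i → w i * (A i · s))
  sum-swap w A s = begin
    sum (λ j → sum (λ i → w i * A i j) * s j)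
      ≈⟨ sum-cong-≋ (λ j → *-distribʳ-sum (s j) (λ i → w i * A i j)) ⟩
    sum (λ j → sum (λ i → w i * A i j * s j))
      ≈⟨ ∑-comm (λ j i → w i * A i j * s j) ⟩
    sum (λ i → sum (λ j → w i * A i j * s j))
      ≈⟨ sum-cong-≋ (λ i → sum-cong-≋ (λ j → *-assoc (w i) (A i j) (s j))) ⟩
    sum (λ i → sum (λ j → w i * (A i j * s j)))
      ≈⟨ sum-cong-≋ (λ i → *-distribˡ-sum (w i) (λ j → A i j * s j)) ⟨
    sum (λ i → w i * (A i · s)) ∎

  ·-linʳ : ∀ {n} (x g h : Vector Carrier n) t → x · (λ j → g j + t * h j) ≈ x · g + t * x · h
  ·-linʳ x g h t = ≈-trans (sum-cong-≋ λ j → lemma (x j) (g j) (h j))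
                              (sum-lin (λ j → x j * g j) (λ j → x j * h j) t)
    where
    lemma : ∀ a b c → a * (b + t * c) ≈ a * b + t * (a * c)
    lemma a b c = ≈-trans (distribˡ a b (t * c)) (+-congˡ (begin
      a * (t * c) ≈⟨ *-assoc a t c ⟨
      a * t * c   ≈⟨ *-congʳ (*-comm a t) ⟩
      t * a * c   ≈⟨ *-assoc t a c ⟩
      t * (a * c) ∎))

  ·-linˡ : ∀ {n} (x y h : Vector Carrier n) t → (λ j → x j + t * y j) · h ≈ x · h + t * y · h
  ·-linˡ x y h t = ≈-trans (sum-cong-≋ λ j → lemma (x j) (y j) (h j))
                              (sum-lin (λ j → x j * h j) (λ j → y j * h j) t)
    where
    lemma : ∀ a b c → (a + t * b) * c ≈ a * c + t * (b * c)
    lemma a b c = ≈-trans (distribʳ c a (t * b)) (+-congˡ (*-assoc t b c))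

  Combination : ∀ {m n} → Vector Carrier m → (Fin m → Vector Carrier n) → Vector Carrier n → Set
  Combination w s x = ∀ j → x j ≈ sum (λ i → w i * s i j)

  ·-combination : ∀ {m n} (w : Vector Carrier m) (s : Fin m → Vector Carrier n) x →
                  Combination w s x → ∀ h → x · h ≈ sum (λ i → w i * s i · h)
  ·-combination w s x x≈ h = ≈-trans (sum-cong-≋ λ j → *-congʳ (x≈ j)) (sum-swap w s h)

  ·-vanish : ∀ {m n} (w : Vector Carrier m) (s : Fin m → Vector Carrier n) x h →
             Combination w s x → (∀ i → s i · h ≈ 0#) → x · h ≈ 0#
  ·-vanish w s x h x≈ s≈0 = ≈-trans (·-combination w s x x≈ h)
    (sum-zero λ i → ≈-trans (*-congˡ (s≈0 i)) (zeroʳ (w i)))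

  Independent : ∀ {m n} → (Fin m → Vector Carrier n) → Set
  Independent {m} s = ∀ (w : Vector Carrier m) → (∀ j → sum (λ i → w i * s i j) ≈ 0#) → ∀ i → w i ≈ 0#

  -- n + 1 linear forms in n unknowns are dependent.
  dependent : ∀ {n} (A : Fin (suc n) → Vector Carrier n) → ¬ Independent A
  dependent {zero}  A ind = 1≉0 (ind (λ _ → 1#) (λ ()) zero)
  dependent {suc n} A ind with em {∃[ j ] ¬ A zero j ≈ 0#}
  ... | no ¬p = 1≉0 (ind w w-kernel zero)
    where
    w : Vector Carrier (suc (suc n))
    w zero    = 1#
    w (suc i) = 0#
    w-kernel : ∀ j → sum (λ i → w i * A i j) ≈ 0#
    w-kernel j = sum-zero {f = λ i → w i * A i j} λ where
      zero    → ≈-trans (*-identityˡ _) (≈-stable λ A≉0 → ¬p (j , A≉0))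
      (suc i) → zeroˡ _
  ... | yes (j₀ , p≉0) = dependent A′ λ w′ ker i → ind (w w′) (w-kernel w′ ker) (suc i)
    where
    q = proj₁ (inverse _ p≉0)
    c : Vector Carrier (suc n)
    c i = - (A (suc i) j₀) * q
    B : Fin (suc n) → Vector Carrier (suc n)
    B i j = A (suc i) j + c i * A zero j
    A′ : Fin (suc n) → Vector Carrier n
    A′ i k = B i (punchIn j₀ k)
    w : Vector Carrier (suc n) → Vector Carrier (suc (suc n))
    w w′ zero    = sum (λ i → w′ i * c i)
    w w′ (suc i) = w′ i
    B-pivot : ∀ i → B i j₀ ≈ 0#
    B-pivot i = begin
      a + - a * q * p   ≈⟨ +-congˡ (*-assoc (- a) q p) ⟩
      a + - a * (q * p) ≈⟨ +-congˡ (*-congˡ (≈-trans (*-comm q p) (proj₂ (inverse _ p≉0)))) ⟩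
      a + - a * 1#      ≈⟨ +-congˡ (*-identityʳ (- a)) ⟩
      a + - a           ≈⟨ -‿inverseʳ a ⟩
      0# ∎
      where
      a = A (suc i) j₀
      p = A zero j₀
    expand : ∀ w′ j → sum (λ i → w w′ i * A i j) ≈ sum (λ i → w′ i * B i j)
    expand w′ j = begin
      sum (λ i → w′ i * c i) * b + sum (λ i → w′ i * A (suc i) j)
        ≈⟨ +-congʳ (*-distribʳ-sum b (λ i → w′ i * c i)) ⟩
      sum (λ i → w′ i * c i * b) + sum (λ i → w′ i * A (suc i) j)
        ≈⟨ +-comm _ _ ⟩
      sum (λ i → w′ i * A (suc i) j) + sum (λ i → w′ i * c i * b)
        ≈⟨ ∑-distrib-+ (λ i → w′ i * A (suc i) j) (λ i → w′ i * c i * b) ⟨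
      sum (λ i → w′ i * A (suc i) j + w′ i * c i * b)
        ≈⟨ sum-cong-≋ (λ i → ≈-trans (+-congˡ (*-assoc (w′ i) (c i) b)) (≈-sym (distribˡ (w′ i) (A (suc i) j) (c i * b)))) ⟩
      sum (λ i → w′ i * B i j) ∎
      where b = A zero j
    w-kernel : ∀ w′ → (∀ k → sum (λ i → w′ i * A′ i k) ≈ 0#) → ∀ j → sum (λ i → w w′ i * A i j) ≈ 0#
    w-kernel w′ ker j with j₀ ≟ᶠ j
    ... | yes refl = ≈-trans (expand w′ j) (sum-zero λ i → ≈-trans (*-congˡ (B-pivot i)) (zeroʳ (w′ i)))
    ... | no j₀≢j  = ≈-trans (expand w′ j)
      (subst (λ k → sum (λ i → w′ i * B i k) ≈ 0#) (punchIn-punchOut j₀≢j) (ker (punchOut j₀≢j)))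

  steinitz : ∀ {m n} (s : Fin m → Vector Carrier n) (u : Fin (suc m) → Vector Carrier n) →
             (∀ i → ∃[ w ] Combination w s (u i)) → ¬ Independent u
  steinitz s u span ind = dependent (proj₁ ∘ span) λ w ker → ind w λ j → begin
    sum (λ i → w i * u i j)
      ≈⟨ sum-cong-≋ (λ i → *-congˡ {w i} (proj₂ (span i) j)) ⟩
    sum (λ i → w i * sum (λ k → proj₁ (span i) k * s k j))
      ≈⟨ sum-swap w (proj₁ ∘ span) (λ k → s k j) ⟨
    (λ k → sum (λ i → w i * proj₁ (span i) k)) · (λ k → s k j)
      ≈⟨ sum-zero (λ k → ≈-trans (*-congʳ (ker k)) (zeroˡ (s k j))) ⟩
    0# ∎

  single : ∀ {n} → Fin n → Carrier → Vector Carrier n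
  single zero    q zero    = q
  single zero    q (suc _) = 0#
  single (suc j) q zero    = 0#
  single (suc j) q (suc i) = single j q i

  ·-single : ∀ {n} (x : Vector Carrier n) j q → x · single j q ≈ x j * q
  ·-single x zero    q = ≈-trans (+-congˡ (sum-zero λ i → zeroʳ (x (suc i)))) (+-identityʳ _)
  ·-single x (suc j) q = ≈-trans (+-cong (zeroʳ (x zero)) (·-single (x ∘ suc) j q)) (+-identityˡ _)

  -- A vector outside the span of s is separated from s by a linear form.
  alternative : ∀ {m n} (s : Fin m → Vector Carrier n) (y : Vector Carrier n) →
                (∃[ w ] Combination w s y) ⊎ (∃[ h ] (∀ i → s i · h ≈ 0#) × y · h ≈ 1#)
  alternative {zero} s y with em {∃[ j ] ¬ y j ≈ 0#}
  ... | no ¬p = inj₁ ((λ ()) , λ j → ≈-stable λ y≉0 → ¬p (j , y≉0))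
  ... | yes (j , y≉0) = inj₂
    ( single j (proj₁ (inverse _ y≉0)) , (λ ())
    , ≈-trans (·-single y j _) (proj₂ (inverse _ y≉0)))
  alternative {suc m} s y with alternative (s ∘ suc) (s zero)
  ... | inj₁ (w₀ , s₀≈) with alternative (s ∘ suc) y
  ...   | inj₁ (w , y≈) = inj₁ (w′ , λ j → ≈-trans (y≈ j)
            (≈-sym (≈-trans (+-congʳ (zeroˡ (s zero j))) (+-identityˡ _))))
    where
    w′ : Vector Carrier (suc m)
    w′ zero    = 0#
    w′ (suc i) = w i
  ...   | inj₂ (h , s≈0 , y≈1) = inj₂ (h , s′≈0 , y≈1)
    where
    s′≈0 : ∀ i → s i · h ≈ 0#
    s′≈0 zero    = ·-vanish w₀ (s ∘ suc) (s zero) h s₀≈ s≈0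
    s′≈0 (suc i) = s≈0 i
  alternative {suc m} s y | inj₂ (g , s·g≈0 , s₀·g≈1)
    with alternative (s ∘ suc) (λ j → y j + - (y · g) * s zero j)
  ... | inj₁ (w , y≈) = inj₁ (w′ , λ j → begin
          y j                                            ≈⟨ cancel₁ (y j) (y · g * s zero j) ⟨
          (y j + - (y · g * s zero j)) + y · g * s zero j  ≈⟨ +-congʳ (+-congˡ (-‿distribˡ-* _ _)) ⟩
          (y j + - (y · g) * s zero j) + y · g * s zero j  ≈⟨ +-comm _ _ ⟩
          y · g * s zero j + (y j + - (y · g) * s zero j)  ≈⟨ +-congˡ (y≈ j) ⟩
          y · g * s zero j + sum (λ i → w i * s (suc i) j) ∎)
    where
    w′ : Vector Carrier (suc m)
    w′ zero    = y · g
    w′ (suc i) = w i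
  ... | inj₂ (h , s·h≈0 , y′·h≈1) = inj₂ (h′ , s·h′≈0 , y·h′≈1)
    where
    t = - (s zero · h)
    h′ = λ j → h j + t * g j
    s·h′≈0 : ∀ i → s i · h′ ≈ 0#
    s·h′≈0 zero = begin
      s zero · h′                  ≈⟨ ·-linʳ (s zero) h g t ⟩
      s zero · h + t * s zero · g  ≈⟨ +-congˡ (≈-trans (*-congˡ s₀·g≈1) (*-identityʳ t)) ⟩
      s zero · h + t               ≈⟨ -‿inverseʳ _ ⟩
      0# ∎
    s·h′≈0 (suc i) = begin
      s (suc i) · h′                     ≈⟨ ·-linʳ (s (suc i)) h g t ⟩
      s (suc i) · h + t * s (suc i) · g  ≈⟨ +-cong (s·h≈0 i) (≈-trans (*-congˡ (s·g≈0 i)) (zeroʳ t)) ⟩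
      0# + 0#                            ≈⟨ +-identityˡ 0# ⟩
      0# ∎
    y·h′≈1 = begin
      y · h′                            ≈⟨ ·-linʳ y h g t ⟩
      y · h + - (s zero · h) * y · g    ≈⟨ +-congˡ (-‿distribˡ-* _ _) ⟨
      y · h + - (s zero · h * y · g)    ≈⟨ +-congˡ (-‿cong (*-comm _ _)) ⟩
      y · h + - (y · g * s zero · h)    ≈⟨ +-congˡ (-‿distribˡ-* _ _) ⟩
      y · h + - (y · g) * s zero · h    ≈⟨ ·-linˡ y (s zero) h (- (y · g)) ⟨
      (λ j → y j + - (y · g) * s zero j) · h  ≈⟨ y′·h≈1 ⟩
      1# ∎

  extend : ∀ {m n} (s : Fin m → Vector Carrier n) (u : Fin (suc m) → Vector Carrier n) →
           Independent s → (∀ i → u (suc i) ≡ s i) →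
           ∀ h → (∀ i → s i · h ≈ 0#) → ¬ u zero · h ≈ 0# → Independent u
  extend s u ind u≡s h s≈0 u₀≉0 w ker = λ where
      zero    → w₀≈0
      (suc i) → ind (w ∘ suc) ker′ i
    where
    su≈0 : ∀ i → u (suc i) · h ≈ 0#
    su≈0 i rewrite u≡s i = s≈0 i
    w₀u₀≈0 : w zero * u zero · h ≈ 0#
    w₀u₀≈0 = begin
      w zero * u zero · h
        ≈⟨ +-identityʳ _ ⟨
      w zero * u zero · h + 0#
        ≈⟨ +-congˡ (sum-zero λ i → ≈-trans (*-congˡ (su≈0 i)) (zeroʳ (w (suc i)))) ⟨
      sum (λ i → w i * u i · h)
        ≈⟨ sum-swap w u h ⟨
      (λ j → sum (λ i → w i * u i j)) · h
        ≈⟨ sum-zero (λ j → ≈-trans (*-congʳ (ker j)) (zeroˡ (h j))) ⟩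
      0# ∎
    w₀≈0 : w zero ≈ 0#
    w₀≈0 with inverse _ u₀≉0
    ... | q , uq≈1 = begin
      w zero                    ≈⟨ *-identityʳ _ ⟨
      w zero * 1#               ≈⟨ *-congˡ uq≈1 ⟨
      w zero * (u zero · h * q) ≈⟨ *-assoc _ _ _ ⟨
      w zero * u zero · h * q   ≈⟨ *-congʳ w₀u₀≈0 ⟩
      0# * q                    ≈⟨ zeroˡ q ⟩
      0# ∎
    ker′ : ∀ j → sum (λ i → w (suc i) * s i j) ≈ 0#
    ker′ j = begin
      sum (λ i → w (suc i) * s i j)
        ≈⟨ sum-cong-≋ (λ i → *-congˡ (≈-reflexive (cong (λ v → v j) (u≡s i)))) ⟨
      sum (λ i → w (suc i) * u (suc i) j)
        ≈⟨ +-identityˡ _ ⟨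
      0# + sum (λ i → w (suc i) * u (suc i) j)
        ≈⟨ +-congʳ (≈-trans (*-congʳ w₀≈0) (zeroˡ _)) ⟨
      sum (λ i → w i * u i j)
        ≈⟨ ker j ⟩
      0# ∎

  tail-independent : ∀ {m n} (u : Fin (suc m) → Vector Carrier n) → Independent u → Independent (u ∘ suc)
  tail-independent {m} u ind w ker i = ind w′ ker′ (suc i)
    where
    w′ : Vector Carrier (suc m)
    w′ zero    = 0#
    w′ (suc i) = w i
    ker′ : ∀ j → sum (λ i → w′ i * u i j) ≈ 0#
    ker′ j = ≈-trans (+-cong (zeroˡ _) (ker j)) (+-identityˡ 0#)

  Positive : Carrier → Set
  Positive x = 0# ≤ x × ¬ x ≈ 0#

  ≤-resp : ∀ {x x′ y y′} → x ≈ x′ → y ≈ y′ → x ≤ y → x′ ≤ y′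
  ≤-resp x≈ y≈ x≤y = ≤.trans (≤.reflexive (≈-sym x≈)) (≤.trans x≤y (≤.reflexive y≈))

  +-nonNeg : ∀ {x y} → 0# ≤ x → 0# ≤ y → 0# ≤ x + y
  +-nonNeg {x} {y} 0≤x 0≤y = ≤.trans 0≤y (≤-resp (+-identityˡ y) ≈-refl (+-monoˡ-≤ y 0≤x))

  diff-nonNeg : ∀ {x y} → x ≤ y → 0# ≤ y + - x
  diff-nonNeg {x} x≤y = ≤-resp (-‿inverseʳ x) ≈-refl (+-monoˡ-≤ (- x) x≤y)

  diff-nonNeg⁻ : ∀ {x y} → 0# ≤ y + - x → x ≤ y
  diff-nonNeg⁻ {x} {y} p = ≤-resp (+-identityˡ x) (cancel₁ y x) (+-monoˡ-≤ x p)

  diff-zero⁻ : ∀ {x y} → y + - x ≈ 0# → x ≈ y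
  diff-zero⁻ {x} {y} p = ≈-sym (≈-trans (≈-sym (cancel₁ y x)) (≈-trans (+-congʳ p) (+-identityˡ x)))

  nonNeg-sum-zeroˡ : ∀ {x y} → 0# ≤ x → 0# ≤ y → x + y ≈ 0# → x ≈ 0#
  nonNeg-sum-zeroˡ {x} {y} 0≤x 0≤y p = ≤.antisym
    (≤-resp (+-identityˡ x) (≈-trans (+-comm y x) p) (+-monoˡ-≤ x 0≤y)) 0≤x

  sum-nonNeg : ∀ {n} {f : Vector Carrier n} → (∀ i → 0# ≤ f i) → 0# ≤ sum f
  sum-nonNeg {zero}  p = ≤.refl
  sum-nonNeg {suc n} p = +-nonNeg (p zero) (sum-nonNeg (p ∘ suc))

  sum-nonNeg-zero : ∀ {n} {f : Vector Carrier n} → (∀ i → 0# ≤ f i) → sum f ≈ 0# → ∀ i → f i ≈ 0#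
  sum-nonNeg-zero {suc n} p e zero    = nonNeg-sum-zeroˡ (p zero) (sum-nonNeg (p ∘ suc)) e
  sum-nonNeg-zero {suc n} p e (suc i) = sum-nonNeg-zero (p ∘ suc)
    (nonNeg-sum-zeroˡ (sum-nonNeg (p ∘ suc)) (p zero) (≈-trans (+-comm _ _) e)) i

  *-zero : ∀ {x y} → ¬ x ≈ 0# → x * y ≈ 0# → y ≈ 0#
  *-zero {x} {y} x≉0 e with inverse x x≉0
  ... | q , xq≈1 = begin
    y            ≈⟨ *-identityˡ y ⟨
    1# * y       ≈⟨ *-congʳ (≈-trans (*-comm q x) xq≈1) ⟨
    q * x * y    ≈⟨ *-assoc q x y ⟩
    q * (x * y)  ≈⟨ *-congˡ e ⟩
    q * 0#       ≈⟨ zeroʳ q ⟩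
    0# ∎

  0≤1 : 0# ≤ 1#
  0≤1 with ≤.total 0# 1#
  ... | inj₁ p = p
  ... | inj₂ p = ≤-resp ≈-refl
    (≈-trans (≈-sym (-‿distribˡ-* 1# (- 1#))) (≈-trans (-‿cong (*-identityˡ (- 1#))) (-‿involutive 1#)))
    (*-nonNeg 0≤-1 0≤-1)
    where
    0≤-1 : 0# ≤ - 1#
    0≤-1 = ≤-resp ≈-refl (+-identityˡ (- 1#)) (diff-nonNeg p)

  argmax : ∀ {n} (Q : Fin n → Set) (φ : Fin n → Carrier) → ∃ Q →
           ∃[ i ] Q i × (∀ j → Q j → φ j ≤ φ i)
  argmax {suc n} Q φ (k , qk) with em {∃ (Q ∘ suc)}
  argmax {suc n} Q φ (zero  , qk) | no ¬q = zero , qk , λ where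
      zero    _  → ≤.refl
      (suc j) qj → contradiction (j , qj) ¬q
  argmax {suc n} Q φ (suc k , qk) | no ¬q = contradiction (k , qk) ¬q
  argmax {suc n} Q φ _ | yes q with argmax (Q ∘ suc) (φ ∘ suc) q
  ... | i , qi , max with em {Q zero × φ (suc i) ≤ φ zero}
  ...   | yes (q₀ , φi≤φ₀) = zero , q₀ , λ where
      zero    _  → ≤.refl
      (suc j) qj → ≤.trans (max j qj) φi≤φ₀
  ...   | no ¬p = suc i , qi , λ where
      zero    q₀ → φ₀≤φi q₀
      (suc j) qj → max j qj
    where
    φ₀≤φi : Q zero → φ zero ≤ φ (suc i)
    φ₀≤φi q₀ with ≤.total (φ zero) (φ (suc i))
    ... | inj₁ p = p
    ... | inj₂ p = contradiction (q₀ , p) ¬p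

  -- The least t with h + t σ ≥ 0 on Q.
  tilt : ∀ {n} (Q : Fin n → Set) (h σ : Fin n → Carrier) → (∀ i → Q i → Positive (σ i)) → ∃ Q →
         ∃[ t ] (∀ i → Q i → 0# ≤ h i + t * σ i) × (∃[ i ] Q i × h i + t * σ i ≈ 0#)
  tilt {n} Q h σ σ>0 ne = φ i₀ , nonNeg , i₀ , q₀ , φ-zero i₀ q₀
    where
    φ : Fin n → Carrier
    φ i with em {σ i ≈ 0#}
    ... | yes _  = 0#
    ... | no σ≉0 = - h i * proj₁ (inverse _ σ≉0)
    φ-zero : ∀ i → Q i → h i + φ i * σ i ≈ 0#
    φ-zero i qi with em {σ i ≈ 0#}
    ... | yes σ≈0 = contradiction σ≈0 (proj₂ (σ>0 i qi))
    ... | no σ≉0 with inverse _ σ≉0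
    ...   | r , σr≈1 = begin
      h i + - h i * r * σ i    ≈⟨ +-congˡ (*-assoc (- h i) r (σ i)) ⟩
      h i + - h i * (r * σ i)  ≈⟨ +-congˡ (*-congˡ (≈-trans (*-comm r (σ i)) σr≈1)) ⟩
      h i + - h i * 1#         ≈⟨ +-congˡ (*-identityʳ (- h i)) ⟩
      h i + - h i              ≈⟨ -‿inverseʳ (h i) ⟩
      0# ∎
    am = argmax Q φ ne
    i₀ = proj₁ am
    q₀ = proj₁ (proj₂ am)
    nonNeg : ∀ i → Q i → 0# ≤ h i + φ i₀ * σ i
    nonNeg i qi = ≤-resp ≈-refl eq
      (*-nonNeg (diff-nonNeg (proj₂ (proj₂ am) i qi)) (proj₁ (σ>0 i qi)))
      where
      eq : (φ i₀ + - φ i) * σ i ≈ h i + φ i₀ * σ i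
      eq = begin
        (φ i₀ + - φ i) * σ i
          ≈⟨ distribʳ (σ i) _ _ ⟩
        φ i₀ * σ i + - φ i * σ i
          ≈⟨ +-congˡ (≈-trans (≈-sym (-‿distribˡ-* _ _)) (≈-sym (+-identityˡ _))) ⟩
        φ i₀ * σ i + (0# + - (φ i * σ i))
          ≈⟨ +-congˡ (+-congʳ (φ-zero i qi)) ⟨
        φ i₀ * σ i + (h i + φ i * σ i + - (φ i * σ i))
          ≈⟨ +-congˡ (cancel₂ (h i) (φ i * σ i)) ⟩
        φ i₀ * σ i + h i
          ≈⟨ +-comm _ _ ⟩
        h i + φ i₀ * σ i ∎

  tilt-strict : ∀ {n} (Q : Fin n → Set) (h σ : Fin n → Carrier) → (∀ i → Q i → Positive (σ i)) →
                ∃[ t ] (∀ i → Q i → Positive (h i + t * σ i))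
  tilt-strict Q h σ σ>0 with em {∃ Q}
  ... | no ¬q = 0# , λ i qi → contradiction (i , qi) ¬q
  ... | yes q with tilt Q h σ σ>0 q
  ...   | t , nonNeg , _ = t + 1# , λ i qi →
    ≤-resp ≈-refl (≈-sym (eq i)) (+-nonNeg (nonNeg i qi) (proj₁ (σ>0 i qi))) ,
    λ e → proj₂ (σ>0 i qi) (nonNeg-sum-zeroˡ (proj₁ (σ>0 i qi)) (nonNeg i qi)
      (≈-trans (+-comm _ _) (≈-trans (≈-sym (eq i)) e)))
    where
    eq : ∀ i → h i + (t + 1#) * σ i ≈ h i + t * σ i + σ i
    eq i = ≈-trans (+-congˡ (≈-trans (distribʳ (σ i) t 1#) (+-congˡ (*-identityˡ (σ i)))))
                   (≈-sym (+-assoc _ _ _))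

-- Excluded middle decides which subsets are faces and which families of
-- points are independent, so that faces can be listed and ranks computed.

module Polytopes (em : ExcludedMiddle 0ℓ) (ℝ : CompleteOrderedField) where

  open CompleteOrderedField ℝ
    renaming (refl to ≈-refl; sym to ≈-sym; trans to ≈-trans; reflexive to ≈-reflexive)
  open LinearAlgebra em ℝ
  open CommutativeMonoidSum +-commutativeMonoid using (sum; sum-cong-≋)
  open RingProperties ring using (-‿distribʳ-*; -1*x≈-x)
  open SetoidReasoning setoid
  open Ehrenborg em

  Point : ℕ → Set
  Point d = Vector Carrier d

  AffinelyIndependent : ∀ {r d} → (Fin r → Point d) → Set
  AffinelyIndependent {r} p = ∀ (w : Vector Carrier r) →
    sum w ≈ 0# → (∀ j → sum (λ i → w i * p i j) ≈ 0#) → ∀ i → w i ≈ 0#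

  ContainsIndependent : ∀ {d} → (Point d → Set) → ℕ → Set
  ContainsIndependent {d} X r =
    Σ[ p ∈ (Fin r → Point d) ] (∀ i → X (p i)) × AffinelyIndependent p

  greatestUpTo : ℕ → (ℕ → Set) → ℕ
  greatestUpTo zero    Q = zero
  greatestUpTo (suc b) Q with em {Q (suc b)}
  ... | yes _ = suc b
  ... | no  _ = greatestUpTo b Q

  -- The greatest number of affinely independent points of X; in ℝ^d there
  -- are never more than d + 1 of them.
  affineRank : ∀ {d} → (Point d → Set) → ℕ
  affineRank {d} X = greatestUpTo (suc d) (ContainsIndependent X)

  -- Meaningful for non-empty X only.
  dimension : ∀ {d} → (Point d → Set) → ℕ
  dimension X = pred (affineRank X)

  record Polytope : Set where
    field
      {ambient} {size} : ℕ
      generators       : Fin (suc size) → Point ambient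

    -- The convex hull of the generators.
    infix 4 _∈P
    _∈P : Point ambient → Set
    x ∈P = Σ[ w ∈ Vector Carrier (suc size) ]
      (∀ i → 0# ≤ w i) × sum w ≈ 1# × (∀ j → x j ≈ sum (λ i → w i * generators i j))

    -- A face is cut out by a valid inequality x · normal ≤ offset; the
    -- normal vector 0 accounts for the empty face and for P itself.
    -- Different inequalities may cut out the same face, see _≈F_ below.
    record Face : Set where
      field
        normal : Vector Carrier ambient
        offset : Carrier
        valid  : ∀ x → x ∈P → x · normal ≤ offset

    open Face

    infix 4 _∋_ _⊆_ _≈F_ _⊂_
    _∋_ : Face → Point ambient → Set
    F ∋ x = x ∈P × x · normal F ≈ offset F

    _⊆_ _≈F_ _⊂_ : Face → Face → Set
    F ⊆ G  = ∀ x → F ∋ x → G ∋ x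
    F ≈F G = F ⊆ G × G ⊆ F
    F ⊂ G  = F ⊆ G × ¬ F ≈F G

    NonEmpty : Face → Set
    NonEmpty F = ∃ (F ∋_)

    dim : Face → ℕ
    dim F = dimension (F ∋_)

    improper : Face
    improper = record
      { normal = λ _ → 0#
      ; offset = 0#
      ; valid  = λ x _ → ≤.reflexive (sum-zero λ j → zeroʳ (x j))
      }

    ⊆-improper : ∀ F → F ⊆ improper
    ⊆-improper F x (x∈P , _) = x∈P , sum-zero λ j → zeroʳ (x j)

  greatest-≤ : ∀ b (Q : ℕ → Set) → greatestUpTo b Q ℕ.≤ b
  greatest-≤ zero    Q = ℕ.z≤n
  greatest-≤ (suc b) Q with em {Q (suc b)}
  ... | yes _ = ℕ.≤-refl
  ... | no  _ = ℕ.m≤n⇒m≤1+n (greatest-≤ b Q)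

  greatest-holds : ∀ b (Q : ℕ → Set) → Q 0 → Q (greatestUpTo b Q)
  greatest-holds zero    Q q₀ = q₀
  greatest-holds (suc b) Q q₀ with em {Q (suc b)}
  ... | yes q = q
  ... | no  _ = greatest-holds b Q q₀

  greatest-≥ : ∀ b (Q : ℕ → Set) {r} → r ℕ.≤ b → Q r → r ℕ.≤ greatestUpTo b Q
  greatest-≥ zero    Q r≤0 q = r≤0
  greatest-≥ (suc b) Q r≤1+b q with em {Q (suc b)}
  ... | yes _ = r≤1+b
  ... | no ¬q with ℕ.m≤n⇒m<n∨m≡n r≤1+b
  ...   | inj₁ (ℕ.s≤s r≤b) = greatest-≥ b Q r≤b q
  ...   | inj₂ refl        = contradiction q ¬q

  hat : ∀ {d} → Point d → Vector Carrier (suc d)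
  hat x zero    = 1#
  hat x (suc j) = x j

  hat-independent : ∀ {r d} (p : Fin r → Point d) → AffinelyIndependent p → Independent (hat ∘ p)
  hat-independent p ind w ker = ind w
    (≈-trans (≈-sym (sum-cong-≋ λ i → *-identityʳ (w i))) (ker zero)) (ker ∘ suc)

  hat-independent⁻ : ∀ {r d} (p : Fin r → Point d) → Independent (hat ∘ p) → AffinelyIndependent p
  hat-independent⁻ p ind w w≈0 ker = ind w λ where
    zero    → ≈-trans (sum-cong-≋ λ i → *-identityʳ (w i)) w≈0
    (suc j) → ker j

  contains-pred : ∀ {d} (X : Point d → Set) {r} → ContainsIndependent X (suc r) → ContainsIndependent X r
  contains-pred X (p , p∈X , ind) = p ∘ suc , p∈X ∘ suc ,
    hat-independent⁻ (p ∘ suc) (tail-independent (hat ∘ p) (hat-independent p ind))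

  contains-≤ : ∀ {d} (X : Point d → Set) r → ContainsIndependent X r → r ℕ.≤ affineRank X
  contains-≤ {d} X zero    c = ℕ.z≤n
  contains-≤ {d} X (suc r) c with suc r ℕ.≤? suc d
  ... | yes r<1+d = greatest-≥ (suc d) (ContainsIndependent X) r<1+d c
  ... | no  r≮1+d with ℕ.≤-antisym
                         (ℕ.≤-trans (contains-≤ X r (contains-pred X c))
                                    (greatest-≤ (suc d) (ContainsIndependent X)))
                         (ℕ.≤-pred (ℕ.≰⇒> r≮1+d))
  ...   | refl = contradiction (hat-independent (proj₁ c) (proj₂ (proj₂ c))) (dependent (hat ∘ proj₁ c))

  contains-affineRank : ∀ {d} (X : Point d → Set) → ContainsIndependent X (affineRank X)
  contains-affineRank {d} X = greatest-holds (suc d) (ContainsIndependent X) ((λ ()) , (λ ()) , (λ _ _ _ ()))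

  contains-down : ∀ {d} (X : Point d → Set) {r s} → r ℕ.≤ s → ContainsIndependent X s → ContainsIndependent X r
  contains-down X {r} r≤s c = go (ℕ.≤⇒≤′ r≤s) c
    where
    go : ∀ {s} → r ℕ.≤′ s → ContainsIndependent X s → ContainsIndependent X r
    go (ℕ.≤′-reflexive refl) c = c
    go (ℕ.≤′-step r≤s)       c = go r≤s (contains-pred X c)

  affineRank-mono : ∀ {d} (X Y : Point d → Set) → (∀ x → X x → Y x) → affineRank X ℕ.≤ affineRank Y
  affineRank-mono X Y X⊆Y with contains-affineRank X
  ... | p , p∈X , ind = contains-≤ Y _ (p , (λ i → X⊆Y _ (p∈X i)) , ind)

  contains-cons : ∀ {r d} (X : Point d → Set) (p : Fin r → Point d) → (∀ i → X (p i)) → AffinelyIndependent p →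
                  ∀ x → X x → ∀ h → (∀ i → hat (p i) · h ≈ 0#) → ¬ hat x · h ≈ 0# → ContainsIndependent X (suc r)
  contains-cons {r} {d} X p p∈X ind x x∈X h p≈0 x≉0 =
    p′ , p′∈X , hat-independent⁻ p′ (extend (hat ∘ p) (hat ∘ p′) (hat-independent p ind) (λ _ → refl) h p≈0 x≉0)
    where
    p′ : Fin (suc r) → Point d
    p′ zero    = x
    p′ (suc i) = p i
    p′∈X : ∀ i → X (p′ i)
    p′∈X zero    = x∈X
    p′∈X (suc i) = p∈X i

  affineRank-spans : ∀ {d} (X : Point d → Set) (p : Fin (affineRank X) → Point d) → (∀ i → X (p i)) →
                     AffinelyIndependent p → ∀ h → (∀ i → hat (p i) · h ≈ 0#) → ∀ x → X x → hat x · h ≈ 0#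
  affineRank-spans X p p∈X ind h p≈0 x x∈X = ≈-stable λ x≉0 →
    ℕ.<-irrefl refl (contains-≤ X _ (contains-cons X p p∈X ind x x∈X h p≈0 x≉0))

  module FaceLattice (P : Polytope) where
    open Polytope P
    open Face

    val : Vector Carrier (suc ambient) → Fin (suc size) → Carrier
    val h i = hat (generators i) · h

    generator-∈P : ∀ i → generators i ∈P
    generator-∈P i = single i 1# , nonNeg i , total i , λ j → ≈-sym (begin
      sum (λ k → single i 1# k * generators k j) ≈⟨ sum-cong-≋ (λ k → *-comm (single i 1# k) (generators k j)) ⟩
      (λ k → generators k j) · single i 1#       ≈⟨ ·-single (λ k → generators k j) i 1# ⟩
      generators i j * 1#                        ≈⟨ *-identityʳ _ ⟩
      generators i j ∎)
      where
      nonNeg : ∀ {n} (i k : Fin n) → 0# ≤ single i 1# k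
      nonNeg zero    zero    = 0≤1
      nonNeg zero    (suc k) = ≤.refl
      nonNeg (suc i) zero    = ≤.refl
      nonNeg (suc i) (suc k) = nonNeg i k
      total : ∀ {n} (i : Fin n) → sum (single i 1#) ≈ 1#
      total {suc n} zero    = ≈-trans (+-congˡ (sum-zero {n} λ _ → ≈-refl)) (+-identityʳ 1#)
      total         (suc i) = ≈-trans (+-identityˡ _) (total i)

    hat-combination : ∀ {x} (x∈P : x ∈P) → Combination (proj₁ x∈P) (hat ∘ generators) (hat x)
    hat-combination (w , _ , w≈1 , x≈) zero    = ≈-sym (≈-trans (sum-cong-≋ λ i → *-identityʳ (w i)) w≈1)
    hat-combination (w , _ , w≈1 , x≈) (suc j) = x≈ j

    ·-val : ∀ {x} (x∈P : x ∈P) h → hat x · h ≈ sum (λ i → proj₁ x∈P i * val h i)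
    ·-val {x} x∈P h = ·-combination (proj₁ x∈P) (hat ∘ generators) (hat x) (hat-combination x∈P) h

    convex-nonNeg : ∀ h → (∀ i → 0# ≤ val h i) → ∀ {x} → x ∈P → 0# ≤ hat x · h
    convex-nonNeg h h≥0 x∈P@(w , w≥0 , _) = ≤-resp ≈-refl (≈-sym (·-val x∈P h))
      (sum-nonNeg λ i → *-nonNeg (w≥0 i) (h≥0 i))

    convex-zero : ∀ h h′ → (∀ i → 0# ≤ val h i) → (∀ i → val h i ≈ 0# → val h′ i ≈ 0#) →
                  ∀ {x} → x ∈P → hat x · h ≈ 0# → hat x · h′ ≈ 0#
    convex-zero h h′ h≥0 h⇒h′ x∈P@(w , w≥0 , _) e = ≈-trans (·-val x∈P h′) (sum-zero term)
      where
      wh≈0 : ∀ i → w i * val h i ≈ 0#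
      wh≈0 = sum-nonNeg-zero (λ i → *-nonNeg (w≥0 i) (h≥0 i)) (≈-trans (≈-sym (·-val x∈P h)) e)
      term : ∀ i → w i * val h′ i ≈ 0#
      term i with em {w i ≈ 0#}
      ... | yes w≈0 = ≈-trans (*-congʳ w≈0) (zeroˡ _)
      ... | no  w≉0 = ≈-trans (*-congˡ (h⇒h′ i (*-zero w≉0 (wh≈0 i)))) (zeroʳ (w i))

    slack : Face → Vector Carrier (suc ambient)
    slack F zero    = offset F
    slack F (suc j) = - normal F j

    ·-slack : ∀ (c : Carrier) (a : Vector Carrier ambient) (h : Vector Carrier (suc ambient)) →
              h zero ≈ c → (∀ j → h (suc j) ≈ - a j) → ∀ x → hat x · h ≈ c + - (x · a)
    ·-slack c a h h₀≈ h≈ x = +-cong (≈-trans (*-identityˡ _) h₀≈) (begin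
      sum (λ j → x j * h (suc j))   ≈⟨ sum-cong-≋ (λ j → *-congˡ (h≈ j)) ⟩
      sum (λ j → x j * - a j)       ≈⟨ sum-cong-≋ (λ j → neg (x j) (a j)) ⟩
      sum (λ j → 0# + - 1# * (x j * a j)) ≈⟨ sum-lin (λ _ → 0#) (λ j → x j * a j) (- 1#) ⟩
      sum {ambient} (λ _ → 0#) + - 1# * x · a ≈⟨ +-cong (sum-zero {ambient} λ _ → ≈-refl) (-1*x≈-x _) ⟩
      0# + - (x · a)                ≈⟨ +-identityˡ _ ⟩
      - (x · a) ∎)
      where
      neg : ∀ b c → b * - c ≈ 0# + - 1# * (b * c)
      neg b c = ≈-trans (≈-sym (-‿distribʳ-* b c)) (≈-sym (≈-trans (+-identityˡ _) (-1*x≈-x (b * c))))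

    slack-≈ : ∀ F x → hat x · slack F ≈ offset F + - (x · normal F)
    slack-≈ F = ·-slack (offset F) (normal F) (slack F) ≈-refl (λ _ → ≈-refl)

    slack-nonNeg : ∀ F i → 0# ≤ val (slack F) i
    slack-nonNeg F i = ≤-resp ≈-refl (≈-sym (slack-≈ F _)) (diff-nonNeg (valid F _ (generator-∈P i)))

    ∈F⇒slack : ∀ F {x} → F ∋ x → hat x · slack F ≈ 0#
    ∈F⇒slack F {x} (_ , e) = ≈-trans (slack-≈ F x) (≈-trans (+-congˡ (-‿cong e)) (-‿inverseʳ _))

    slack⇒∈F : ∀ F {x} → x ∈P → hat x · slack F ≈ 0# → F ∋ x
    slack⇒∈F F {x} x∈P e = x∈P , diff-zero⁻ (≈-trans (≈-sym (slack-≈ F x)) e)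

    fromSlack : ∀ h → (∀ i → 0# ≤ val h i) → Face
    fromSlack h h≥0 = record
      { normal = λ j → - h (suc j)
      ; offset = h zero
      ; valid  = λ x x∈P → diff-nonNeg⁻ (≤-resp ≈-refl (fromSlack-≈ x) (convex-nonNeg h h≥0 x∈P))
      }
      where
      fromSlack-≈ : ∀ x → hat x · h ≈ h zero + - (x · (λ j → - h (suc j)))
      fromSlack-≈ = ·-slack (h zero) (λ j → - h (suc j)) h ≈-refl (λ j → ≈-sym (-‿involutive _))
        where open RingProperties ring using (-‿involutive)

    ∈fromSlack : ∀ h h≥0 {x} → x ∈P → hat x · h ≈ 0# → fromSlack h h≥0 ∋ x
    ∈fromSlack h h≥0 {x} x∈P e = x∈P , diff-zero⁻ (≈-trans (≈-sym
      (·-slack (h zero) (λ j → - h (suc j)) h ≈-refl (λ j → ≈-sym (-‿involutive _)) x)) e)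
      where open RingProperties ring using (-‿involutive)

    ∈fromSlack⁻ : ∀ h h≥0 {x} → fromSlack h h≥0 ∋ x → hat x · h ≈ 0#
    ∈fromSlack⁻ h h≥0 {x} (_ , e) = ≈-trans
      (·-slack (h zero) (λ j → - h (suc j)) h ≈-refl (λ j → ≈-sym (-‿involutive _)) x)
      (≈-trans (+-congˡ (-‿cong e)) (-‿inverseʳ _))
      where open RingProperties ring using (-‿involutive)

    -- A face is determined by the generators which it contains.
    ⊆-generators : ∀ F G → (∀ i → F ∋ generators i → G ∋ generators i) → F ⊆ G
    ⊆-generators F G F⇒G x x∈F = slack⇒∈F G (proj₁ x∈F)
      (convex-zero (slack F) (slack G) (slack-nonNeg F)
        (λ i e → ∈F⇒slack G (F⇒G i (slack⇒∈F F (generator-∈P i) e)))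
        (proj₁ x∈F) (∈F⇒slack F x∈F))

    ≉F-witness : ∀ {F G} → ¬ G ⊆ F → ∃[ x ] G ∋ x × ¬ F ∋ x
    ≉F-witness {F} {G} G⊈F with em {∃[ x ] G ∋ x × ¬ F ∋ x}
    ... | yes p = p
    ... | no ¬p = contradiction (λ x x∈G → decidable-stable em λ x∉F → ¬p (x , x∈G , x∉F)) G⊈F

    affineRank-⊂ : ∀ F G → F ⊂ G → affineRank (F ∋_) ℕ.< affineRank (G ∋_)
    affineRank-⊂ F G (F⊆G , F≉G)
      with contains-affineRank (F ∋_) | ≉F-witness {F} {G} (λ G⊆F → F≉G (F⊆G , G⊆F))
    ... | p , p∈F , ind | x , x∈G , x∉F = contains-≤ (G ∋_) _
      (contains-cons (G ∋_) p (λ i → F⊆G _ (p∈F i)) ind x x∈G (slack F)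
        (λ i → ∈F⇒slack F (p∈F i)) (λ e → x∉F (slack⇒∈F F (proj₁ x∈G) e)))

    -- A hyperplane which contains F and another point of G, but not all of G.
    separate : ∀ F G → F ⊂ G → suc (affineRank (F ∋_)) ℕ.< affineRank (G ∋_) →
               ∃[ h ] (∀ z → F ∋ z → hat z · h ≈ 0#) ×
                      (∃[ x ] G ∋ x × ¬ F ∋ x × hat x · h ≈ 0#) ×
                      (∃[ y ] G ∋ y × hat y · h ≈ 1#)
    separate F G (F⊆G , F≉G) 1+rF<rG
      with contains-affineRank (F ∋_)
         | contains-down (G ∋_) 1+rF<rG (contains-affineRank (G ∋_))
         | ≉F-witness {F} {G} (λ G⊆F → F≉G (F⊆G , G⊆F))
    ... | p , p∈F , p-ind | g , g∈G , g-ind | x , x∈G , x∉F = conclude (em {∃ Separated})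
      where
      s : Fin (suc (affineRank (F ∋_))) → Vector Carrier (suc ambient)
      s zero    = hat x
      s (suc i) = hat (p i)

      Separated : Fin (suc (suc (affineRank (F ∋_)))) → Set
      Separated i = ∃[ h ] (∀ k → s k · h ≈ 0#) × hat (g i) · h ≈ 1#

      spans : ¬ ∃ Separated → ∀ i → ∃[ w ] Combination w s (hat (g i))
      spans ¬sep i with alternative s (hat (g i))
      ... | inj₁ c   = c
      ... | inj₂ sep = contradiction (i , sep) ¬sep

      conclude : Dec (∃ Separated) → _
      conclude (no ¬sep) = ⊥-elim (steinitz s (hat ∘ g) (spans ¬sep) (hat-independent g g-ind))
      conclude (yes (i , h , s·h≈0 , y·h≈1)) =
        h , affineRank-spans (F ∋_) p p∈F p-ind h (s·h≈0 ∘ suc) ,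
        (x , x∈G , x∉F , s·h≈0 zero) , (g i , g∈G i , y·h≈1)

    -- Tilt the supporting hyperplane of F around F until it meets another
    -- point of G, then around G so that it supports P.
    module Between (F G : Face) (F⊆G : F ⊆ G) (h : Vector Carrier (suc ambient))
                   (F·h≈0 : ∀ z → F ∋ z → hat z · h ≈ 0#) where

      σF σG : Fin (suc size) → Carrier
      σF = val (slack F)
      σG = val (slack G)

      G∖F : Fin (suc size) → Set
      G∖F i = σG i ≈ 0# × ¬ σF i ≈ 0#

      inF : ∀ i → σF i ≈ 0# → F ∋ generators i
      inF i = slack⇒∈F F (generator-∈P i)

      inG : ∀ i → σG i ≈ 0# → G ∋ generators i
      inG i = slack⇒∈F G (generator-∈P i)

      G∖F-nonEmpty : ∀ x → G ∋ x → ¬ F ∋ x → ∃ G∖F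
      G∖F-nonEmpty x x∈G x∉F = decidable-stable em λ ¬q → x∉F (⊆-generators G F
        (λ i v∈G → inF i (≈-stable λ σ≉0 → ¬q (i , ∈F⇒slack G v∈G , σ≉0))) x x∈G)

      module First (t : Carrier) (nonNeg : ∀ i → G∖F i → 0# ≤ val h i + t * σF i) where

        h₁ : Vector Carrier (suc ambient)
        h₁ j = h j + t * slack F j

        h₁-≈ : ∀ z → hat z · h₁ ≈ hat z · h + t * hat z · slack F
        h₁-≈ z = ·-linʳ (hat z) h (slack F) t

        F·h₁≈0 : ∀ z → F ∋ z → hat z · h₁ ≈ 0#
        F·h₁≈0 z z∈F = ≈-trans (h₁-≈ z) (≈-trans (+-cong (F·h≈0 z z∈F)
          (≈-trans (*-congˡ (∈F⇒slack F z∈F)) (zeroʳ t))) (+-identityˡ 0#))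

        h₁-nonNeg : ∀ i → σG i ≈ 0# → 0# ≤ val h₁ i
        h₁-nonNeg i σG≈0 with em {σF i ≈ 0#}
        ... | yes σF≈0 = ≤.reflexive (≈-sym (F·h₁≈0 (generators i) (inF i σF≈0)))
        ... | no  σF≉0 = ≤-resp ≈-refl (≈-sym (h₁-≈ (generators i))) (nonNeg i (σG≈0 , σF≉0))

        module Second (N : Carrier)
                      (positive : ∀ i → ¬ σG i ≈ 0# → Positive (val h₁ i + N * σG i)) where

          h₂ : Vector Carrier (suc ambient)
          h₂ j = h₁ j + N * slack G j

          h₂-≈ : ∀ z → hat z · h₂ ≈ hat z · h₁ + N * hat z · slack G
          h₂-≈ z = ·-linʳ (hat z) h₁ (slack G) N

          h₂-≈h₁ : ∀ z → hat z · slack G ≈ 0# → hat z · h₂ ≈ hat z · h₁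
          h₂-≈h₁ z e = ≈-trans (h₂-≈ z)
            (≈-trans (+-congˡ (≈-trans (*-congˡ e) (zeroʳ N))) (+-identityʳ _))

          h₂-nonNeg : ∀ i → 0# ≤ val h₂ i
          h₂-nonNeg i with em {σG i ≈ 0#}
          ... | yes σG≈0 = ≤-resp ≈-refl (≈-sym (h₂-≈h₁ (generators i) σG≈0)) (h₁-nonNeg i σG≈0)
          ... | no  σG≉0 = ≤-resp ≈-refl (≈-sym (h₂-≈ (generators i))) (proj₁ (positive i σG≉0))

          H : Face
          H = fromSlack h₂ h₂-nonNeg

          F⊆H : F ⊆ H
          F⊆H z z∈F = ∈fromSlack h₂ h₂-nonNeg (proj₁ z∈F)
            (≈-trans (h₂-≈h₁ z (∈F⇒slack G (F⊆G z z∈F))) (F·h₁≈0 z z∈F))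

          H⊆G : H ⊆ G
          H⊆G = ⊆-generators H G λ i v∈H → inG i (≈-stable λ σG≉0 → proj₂ (positive i σG≉0)
            (≈-trans (≈-sym (h₂-≈ (generators i))) (∈fromSlack⁻ h₂ h₂-nonNeg v∈H)))

          F≉H : (∃[ i ] G∖F i × val h i + t * σF i ≈ 0#) → ¬ F ≈F H
          F≉H (i , (σG≈0 , σF≉0) , e) (_ , H⊆F) = σF≉0 (∈F⇒slack F (H⊆F (generators i)
            (∈fromSlack h₂ h₂-nonNeg (generator-∈P i)
              (≈-trans (h₂-≈h₁ (generators i) σG≈0) (≈-trans (h₁-≈ (generators i)) e)))))

          H≉G : (∃[ x ] G ∋ x × ¬ F ∋ x × hat x · h ≈ 0#) → (∃[ y ] G ∋ y × hat y · h ≈ 1#) →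
                ¬ H ≈F G
          H≉G (x , x∈G , x∉F , x·h≈0) (y , y∈G , y·h≈1) (_ , G⊆H) = 1≉0 (begin
            1#                                ≈⟨ y·h≈1 ⟨
            hat y · h                         ≈⟨ +-identityʳ _ ⟨
            hat y · h + 0#                    ≈⟨ +-congˡ (≈-trans (*-congʳ t≈0) (zeroˡ _)) ⟨
            hat y · h + t * hat y · slack F   ≈⟨ on-G y y∈G ⟩
            0# ∎)
            where
            on-G : ∀ z → G ∋ z → hat z · h + t * hat z · slack F ≈ 0#
            on-G z z∈G = ≈-trans (≈-sym (h₁-≈ z)) (≈-trans (≈-sym (h₂-≈h₁ z (∈F⇒slack G z∈G)))
              (∈fromSlack⁻ h₂ h₂-nonNeg (G⊆H z z∈G)))
            t≈0 : t ≈ 0#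
            t≈0 = *-zero (λ e → x∉F (slack⇒∈F F (proj₁ x∈G) e)) (begin
              hat x · slack F * t             ≈⟨ *-comm _ _ ⟩
              t * hat x · slack F             ≈⟨ +-identityˡ _ ⟨
              0# + t * hat x · slack F        ≈⟨ +-congʳ x·h≈0 ⟨
              hat x · h + t * hat x · slack F ≈⟨ on-G x x∈G ⟩
              0# ∎)

    between : ∀ F G → F ⊂ G → suc (affineRank (F ∋_)) ℕ.< affineRank (G ∋_) →
              ∃[ H ] F ⊂ H × H ⊂ G
    between F G F⊂G@(F⊆G , _) 1+rF<rG with separate F G F⊂G 1+rF<rG
    ... | h , F·h≈0 , wx@(x , x∈G , x∉F , _) , wy =
      let open Between F G F⊆G h F·h≈0
          (t , nonNeg , touches) = tilt G∖F (val h) σF (λ i q → slack-nonNeg F i , proj₂ q)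
                                        (G∖F-nonEmpty x x∈G x∉F)
          open First t nonNeg
          (N , positive) = tilt-strict (λ i → ¬ σG i ≈ 0#) (val h₁) σG (λ i q → slack-nonNeg G i , q)
          open Second N positive
      in H , (F⊆H , F≉H touches) , (H⊆G , H≉G wx wy)

    affineRank-covers : ∀ F G → F ⊂ G → (∀ H → ¬ (F ⊂ H × H ⊂ G)) →
                        affineRank (G ∋_) ≡ suc (affineRank (F ∋_))
    affineRank-covers F G F⊂G no-between = ℕ.≤-antisym
      (ℕ.≮⇒≥ λ 1+rF<rG → let (H , F⊂H , H⊂G) = between F G F⊂G 1+rF<rG in no-between H (F⊂H , H⊂G))
      (affineRank-⊂ F G F⊂G)

    faceSetoid : Setoid 0ℓ 0ℓ
    faceSetoid = record
      { Carrier       = Face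
      ; _≈_           = _≈F_
      ; isEquivalence = record
        { refl  = (λ _ → id) , (λ _ → id)
        ; sym   = λ (F⊆G , G⊆F) → G⊆F , F⊆G
        ; trans = λ (F⊆G , G⊆F) (G⊆H , H⊆G) → (λ x → G⊆H x ∘ F⊆G x) , (λ x → G⊆F x ∘ H⊆G x)
        }
      }

    Represents : Vec Bool (suc size) → Face → Set
    Represents S F = ∀ i → Vec.lookup S i ≡ true ⇔ F ∋ generators i

    faces : List Face
    faces = map (proj₁ ∘ proj₂)
      (select (λ S → em {∃ (Represents S)}) (tuples (suc size) (true ∷ false ∷ [])))

    nonEmptyFaces : List Face
    nonEmptyFaces = map proj₁ (select (λ F → em {NonEmpty F}) faces)

    faces-complete : IsEnumeration faceSetoid faces
    faces-complete F = Any.map⁺ (Any.map (λ {T} → same T) (select-Any (λ S → em {∃ (Represents S)})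
        (λ { refl → F , S-represents }) (tuples-complete bools S)))
      where
      does-⇔ : ∀ {A : Set} (A? : Dec A) → does A? ≡ true ⇔ A
      does-⇔ (yes a) = mk⇔ (λ _ → a) (λ _ → refl)
      does-⇔ (no ¬a) = mk⇔ (λ ()) (λ a → contradiction a ¬a)
      bools : ∀ b → b ∈ true ∷ false ∷ []
      bools true  = here refl
      bools false = there (here refl)
      S = Vec.tabulate (λ i → does (em {F ∋ generators i}))
      S-represents : Represents S F
      S-represents i = subst (λ b → b ≡ true ⇔ F ∋ generators i)
        (sym (Vec.lookup∘tabulate (λ i → does (em {F ∋ generators i})) i)) (does-⇔ em)
      same : ∀ (T : Σ (Vec Bool (suc size)) (∃ ∘ Represents)) → S ≡ proj₁ T → F ≈F proj₁ (proj₂ T)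
      same (_ , G , r) refl =
        ⊆-generators F G (λ i → Equivalence.to (r i) ∘ Equivalence.from (S-represents i)) ,
        ⊆-generators G F (λ i → Equivalence.to (S-represents i) ∘ Equivalence.from (r i))

    faces-unique : Unique faceSetoid faces
    faces-unique = AllPairs.map⁺ (AllPairs.map (λ {S} {T} → distinct S T)
      (select-AllPairs (λ S → em {∃ (Represents S)}) (tuples-unique bools-unique (suc size))))
      where
      bools-unique : Unique≡ (true ∷ false ∷ [])
      bools-unique = ((λ ()) ∷ []) ∷ [] ∷ []
      ⇔⇒≡ : ∀ {a b} → (a ≡ true → b ≡ true) → (b ≡ true → a ≡ true) → a ≡ b
      ⇔⇒≡ {true}         f g = sym (f refl)
      ⇔⇒≡ {false} {true} f g = g refl
      ⇔⇒≡ {false} {false} f g = refl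
      distinct : ∀ (S T : Σ (Vec Bool (suc size)) (∃ ∘ Represents)) → proj₁ S ≢ proj₁ T → ¬ proj₁ (proj₂ S) ≈F proj₁ (proj₂ T)
      distinct (S , F , r) (T , G , q) S≢T (F⊆G , G⊆F) = S≢T
        (trans (sym (Vec.tabulate∘lookup S)) (trans (Vec.tabulate-cong pointwise) (Vec.tabulate∘lookup T)))
        where
        pointwise : ∀ i → Vec.lookup S i ≡ Vec.lookup T i
        pointwise i = ⇔⇒≡ (Equivalence.from (q i) ∘ F⊆G _ ∘ Equivalence.to (r i))
                          (Equivalence.from (r i) ∘ G⊆F _ ∘ Equivalence.to (q i))

    -- The interval [F , P].
    interval : Face → GradedPoset
    interval F = record
      { poset = record
        { Carrier        = Above
        ; _≈_            = λ G H → proj₁ G ≈F proj₁ H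
        ; _≤_            = λ G H → proj₁ G ⊆ proj₁ H
        ; isPartialOrder = record
          { isPreorder = record
            { isEquivalence = record
              { refl  = λ {G} → ≈F.refl {proj₁ G}
              ; sym   = λ {G} {H} → ≈F.sym {proj₁ G} {proj₁ H}
              ; trans = λ {G} {H} {K} → ≈F.trans {proj₁ G} {proj₁ H} {proj₁ K}
              }
            ; reflexive     = proj₁
            ; trans         = λ G⊆H H⊆K x → H⊆K x ∘ G⊆H x
            }
          ; antisym    = _,_
          }
        }
      ; elements          = select (λ G → em {F ⊆ G}) faces
      ; elements-complete = λ G → select-Any (λ G → em {F ⊆ G})
          (λ G≈H x → proj₁ G≈H x ∘ proj₂ G x) (faces-complete (proj₁ G))
      ; elements-unique   = select-AllPairs (λ G → em {F ⊆ G}) faces-unique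
      ; 0̂                 = F , λ _ → id
      ; 1̂                 = improper , ⊆-improper F
      ; 0̂-minimum         = proj₂
      ; 1̂-maximum         = λ G → ⊆-improper (proj₁ G)
      ; ρ                 = λ G → affineRank (proj₁ G ∋_) ∸ affineRank (F ∋_)
      ; ρ-cong            = λ {G} {H} (G⊆H , H⊆G) → cong (_∸ affineRank (F ∋_)) (ℕ.≤-antisym
          (affineRank-mono (proj₁ G ∋_) (proj₁ H ∋_) G⊆H) (affineRank-mono (proj₁ H ∋_) (proj₁ G ∋_) H⊆G))
      ; ρ-0̂               = ℕ.n∸n≡0 (affineRank (F ∋_))
      ; ρ-covers          = λ {G} {H} (G⊂H , no-between) → trans
          (cong (_∸ affineRank (F ∋_)) (affineRank-covers (proj₁ G) (proj₁ H) G⊂H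
            λ K (G⊂K , K⊂H) → no-between (K , λ x → proj₁ G⊂K x ∘ proj₂ G x) (G⊂K , K⊂H)))
          (ℕ.+-∸-assoc 1 (affineRank-mono (F ∋_) (proj₁ G ∋_) (proj₂ G)))
      }
      where
      Above = Σ[ G ∈ Face ] F ⊆ G
      module ≈F = Setoid faceSetoid

  -- Generators are polytopes rather than combinatorial types; lα and f only
  -- depend on the face lattice.
  𝓟 : Set
  𝓟 = FreeModule Polytope

  l₀ : Polytope → 𝓡[α]
  l₀ P = ∑[ F ← nonEmptyFaces ] gen (dim F , interval F)
    where
    open Polytope P
    open FaceLattice P

  lα : 𝓟 → 𝓡[α]
  lα = linear l₀

  module _ (P : Polytope) where
    open Polytope P
    open FaceLattice P

    -- f_(a₁,…,aₖ), the number of chains F₁ ⊂ … ⊂ Fₖ of faces with dim Fᵢ = aᵢ.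
    flagNumber : ∀ {k} → Vec ℕ k → ℕ
    flagNumber {k} a = length (select (λ c → em {Linked _⊂_ (toList c) × Vec.map dim c ≡ a})
                                      (tuples k nonEmptyFaces))

    dimP : ℕ
    dimP = dim improper

    -- 0 ≤ a₁ < … < aₖ ≤ n - 1, where n = dim P.
    IsFlagType : ∀ {k} → Vec ℕ k → Set
    IsFlagType a = Linked ℕ._<_ (toList a ++ dimP ∷ [])

    flagTypes : ∀ k → List (Σ (Vec ℕ k) IsFlagType)
    flagTypes k = select (λ a → Linked.linked? ℕ._<?_ (toList a ++ dimP ∷ [])) (tuples k (upTo dimP))

    -- f_(a₁,…,aₖ) α ^ a₁ M_(n - aₖ , aₖ - aₖ₋₁ , … , a₂ - a₁).
    flagTerm : ∀ {k} → Σ (Vec ℕ (suc k)) IsFlagType → QSym[α]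
    flagTerm (a , a↗) = ℤ.+ flagNumber a ⊙ gen (Vec.head a , rev (gaps a↗))

    f : QSym[α]
    f = gen (dimP , ε) ++ (∑[ k-1 ← upTo dimP ] ∑[ a ← flagTypes (suc k-1) ] flagTerm a)

{-# OPTIONS --safe #-}
module Submission where

-- Both sides are sums, over the flags F₁ ⊂ … ⊂ Fₖ ⊂ P of non-empty faces, of
-- α ^ dim F₁ times the monomial function whose exponents are the successive
-- jumps of dimension.  On the left F₁ is the face of the interval [F₁ , P] and
-- the other faces form a chain in that interval, whose rank function differs
-- from dim by a constant; on the right the flags are first grouped by their
-- dimensions.  The empty flag stands for α ^ dim P, which comes from the
-- trivial interval [P , P].
-- This holds after applying any additive function on generators, in
-- particular each coefficient.

open import Defs
open import Axiom.ExcludedMiddle using (ExcludedMiddle)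
open import Level using (Level; 0ℓ)

open import Data.Bool.Base using (if_then_else_)
open import Data.Fin.Base as Fin using (Fin; zero; suc)
import Data.Fin.Properties as Fin
open import Data.Integer.Base as ℤ using (ℤ; 0ℤ; 1ℤ; _+_; _*_)
import Data.Integer.Properties as ℤ
open import Algebra.Properties.CommutativeSemigroup ℤ.+-commutativeSemigroup using (interchange)
open import Data.List.Base
  using ( List; []; _∷_; _++_; map; concatMap; cartesianProductWith; length; lookup; reverse
        ; upTo; applyUpTo )
open import Data.List.Membership.Propositional using (_∈_)
open import Data.List.Membership.Propositional.Properties
  using (∈-cartesianProductWith⁺; ∈-lookup; ∈-upTo⁺)
import Data.List.Properties as List
open import Data.List.Relation.Unary.All as All using (All; []; _∷_)
import Data.List.Relation.Unary.All.Properties as All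
open import Data.List.Relation.Unary.AllPairs as AllPairs using (AllPairs; []; _∷_)
import Data.List.Relation.Unary.AllPairs.Properties as AllPairs
open import Data.List.Relation.Unary.Any as Any using (Any; here; there)
import Data.List.Relation.Unary.Any.Properties as Any
open import Data.List.Relation.Unary.Linked as Linked using (Linked; []; [-]; _∷_)
import Data.List.Relation.Unary.Linked.Properties as Linked
import Data.List.Relation.Unary.Unique.Propositional.Properties as Unique
open import Data.Nat.Base as ℕ using (ℕ; zero; suc; pred; _∸_; _≤_; _<_; z≤n; s≤s)
import Data.Nat.Properties as ℕ
open import Data.Product using (Σ; _×_; _,_; proj₁; proj₂)
open import Data.Vec.Base as Vec using (Vec; []; _∷_; toList)
import Data.Vec.Properties as Vec
open import Function.Base using (_∘_; id)
open import Relation.Binary.Bundles using (Poset)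
open import Relation.Binary.Core using (Rel)
import Relation.Binary.Construct.NonStrictToStrict as NonStrictToStrict
open import Relation.Binary.PropositionalEquality
  using (_≡_; refl; sym; trans; cong; cong₂; subst; module ≡-Reasoning)
open import Relation.Nullary.Decidable.Core using (Dec; yes; no)
open import Relation.Nullary.Negation using (¬_; contradiction)
open import Relation.Unary using (Decidable)

private variable
  a b q r : Level
  A : Set a
  B : Set b
  xs : List A

-- Finite sums of integers over lists.

total : List A → (A → ℤ) → ℤ
total []       f = 0ℤ
total (x ∷ xs) f = f x + total xs f

total-congAll : ∀ {f g : A → ℤ} → All (λ x → f x ≡ g x) xs → total xs f ≡ total xs g
total-congAll []       = refl
total-congAll (e ∷ es) = cong₂ _+_ e (total-congAll es)

total-cong : ∀ (xs : List A) {f g : A → ℤ} → (∀ x → f x ≡ g x) → total xs f ≡ total xs g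
total-cong xs f≡g = total-congAll (All.universal f≡g xs)

total-zero : ∀ (xs : List A) {f : A → ℤ} → (∀ x → f x ≡ 0ℤ) → total xs f ≡ 0ℤ
total-zero []       f≡0 = refl
total-zero (x ∷ xs) f≡0 = cong₂ _+_ (f≡0 x) (total-zero xs f≡0)

total-++ : ∀ (xs ys : List A) (f : A → ℤ) → total (xs ++ ys) f ≡ total xs f + total ys f
total-++ []       ys f = sym (ℤ.+-identityˡ _)
total-++ (x ∷ xs) ys f = trans (cong (f x +_) (total-++ xs ys f)) (sym (ℤ.+-assoc (f x) _ _))

total-map : ∀ (h : A → B) xs (f : B → ℤ) → total (map h xs) f ≡ total xs (f ∘ h)
total-map h []       f = refl
total-map h (x ∷ xs) f = cong (f (h x) +_) (total-map h xs f)

total-concatMap : ∀ (h : A → List B) xs (f : B → ℤ) →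
                  total (concatMap h xs) f ≡ total xs (λ x → total (h x) f)
total-concatMap h []       f = refl
total-concatMap h (x ∷ xs) f =
  trans (total-++ (h x) _ f) (cong (total (h x) f +_) (total-concatMap h xs f))

total-+ : ∀ (xs : List A) (f g : A → ℤ) → total xs (λ x → f x + g x) ≡ total xs f + total xs g
total-+ []       f g = refl
total-+ (x ∷ xs) f g =
  trans (cong (f x + g x +_) (total-+ xs f g)) (interchange (f x) (g x) _ _)

total-*ˡ : ∀ (xs : List A) c (f : A → ℤ) → total xs (λ x → c * f x) ≡ c * total xs f
total-*ˡ []       c f = sym (ℤ.*-zeroʳ c)
total-*ˡ (x ∷ xs) c f = trans (cong (c * f x +_) (total-*ˡ xs c f)) (sym (ℤ.*-distribˡ-+ c (f x) _))

total-*ʳ : ∀ (xs : List A) (f : A → ℤ) c → total xs f * c ≡ total xs (λ x → f x * c)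
total-*ʳ xs f c = trans (ℤ.*-comm _ c)
  (trans (sym (total-*ˡ xs c f)) (total-cong xs λ x → ℤ.*-comm c (f x)))

total-swap : ∀ (xs : List A) (ys : List B) (f : A → B → ℤ) →
             total xs (λ x → total ys (f x)) ≡ total ys (λ y → total xs (λ x → f x y))
total-swap []       ys f = sym (total-zero ys λ _ → refl)
total-swap (x ∷ xs) ys f =
  trans (cong (total ys (f x) +_) (total-swap xs ys f)) (sym (total-+ ys (f x) _))

-- Only indices below both bounds can contribute. This reconciles the two cut-offs on the length of
-- a chain: the number of elements of an interval in `F₀`, and `dimP` in `f`.
total-applyUpTo : ∀ (g : ℕ → A) (f : A → ℤ) m n →
                  (∀ k → m ≤ k → f (g k) ≡ 0ℤ) → (∀ k → n ≤ k → f (g k) ≡ 0ℤ) →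
                  total (applyUpTo g m) f ≡ total (applyUpTo g n) f
total-applyUpTo g f zero    zero    m0 n0 = refl
total-applyUpTo g f zero    (suc n) m0 n0 = cong₂ _+_ (sym (m0 0 z≤n))
  (total-applyUpTo (g ∘ suc) f zero n (λ k _ → m0 (suc k) z≤n) (λ k → n0 (suc k) ∘ s≤s))
total-applyUpTo g f (suc m) zero    m0 n0 = cong₂ _+_ (n0 0 z≤n)
  (total-applyUpTo (g ∘ suc) f m zero (λ k → m0 (suc k) ∘ s≤s) (λ k _ → n0 (suc k) z≤n))
total-applyUpTo g f (suc m) (suc n) m0 n0 = cong (f (g 0) +_)
  (total-applyUpTo (g ∘ suc) f m n (λ k → m0 (suc k) ∘ s≤s) (λ k → n0 (suc k) ∘ s≤s))

-- Sums restricted by a decidable condition.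

when : Dec A → ℤ → ℤ
when (yes _) i = i
when (no _)  i = 0ℤ

when-cong : ∀ (a? : Dec A) (b? : Dec B) {i j} → (A → B) → (B → A) → (A → i ≡ j) →
            when a? i ≡ when b? j
when-cong (yes x) (yes _) f g e = e x
when-cong (yes x) (no ¬y) f g e = contradiction (f x) ¬y
when-cong (no ¬x) (yes y) f g e = contradiction (g y) ¬x
when-cong (no _)  (no _)  f g e = refl

when-yes : ∀ (a? : Dec A) {i} → A → when a? i ≡ i
when-yes (yes _) x = refl
when-yes (no ¬x) x = contradiction x ¬x

when-no : ∀ (a? : Dec A) {i} → ¬ A → when a? i ≡ 0ℤ
when-no (yes x) ¬x = contradiction x ¬x
when-no (no _)  ¬x = refl

when-0 : ∀ (a? : Dec A) → when a? 0ℤ ≡ 0ℤ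
when-0 (yes _) = refl
when-0 (no _)  = refl

when-*ʳ : ∀ (a? : Dec A) i j → when a? i * j ≡ when a? (i * j)
when-*ʳ (yes _) i j = refl
when-*ʳ (no _)  i j = ℤ.*-zeroˡ j

total-when : ∀ (xs : List A) (b? : Dec B) (f : A → ℤ) →
             total xs (λ x → when b? (f x)) ≡ when b? (total xs f)
total-when xs (yes _) f = refl
total-when xs (no _)  f = total-zero xs λ _ → refl

-- `Any` supplies a position where `Q` holds and `AllPairs` excludes a second one. Pairwise
-- incompatibility is asked for instead of distinctness, so that `Q` may also be an equality up to
-- `≈F`.
total-single : ∀ {Q : A → Set q} (Q? : Decidable Q) {f : A → ℤ} {i} →
               AllPairs (λ x y → ¬ (Q x × Q y)) xs → Any Q xs → (∀ x → Q x → f x ≡ i) →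
               total xs (λ x → when (Q? x) (f x)) ≡ i
total-single {xs = x ∷ xs} Q? (¬qs ∷ _) (here qx) f≡i =
  trans (cong₂ _+_ (trans (when-yes (Q? x) qx) (f≡i x qx))
                   (trans (total-congAll (All.map (λ {y} ¬q → when-no (Q? y) λ qy → ¬q (qx , qy)) ¬qs))
                          (total-zero xs λ _ → refl)))
        (ℤ.+-identityʳ _)
total-single {xs = x ∷ xs} Q? (¬qs ∷ pairs) (there qxs) f≡i =
  trans (cong₂ _+_ (when-no (Q? x) λ qx → All.All¬⇒¬Any (All.map (λ ¬q qy → ¬q (qx , qy)) ¬qs) qxs)
                   (total-single Q? pairs qxs f≡i))
        (ℤ.+-identityˡ _)

-- A filtered list becomes a weight on the full list. In this form the summation domain no longer
-- depends on the condition, and sums can be exchanged.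
total-select : ∀ {Q : A → Set q} (Q? : Decidable Q) xs {f : Σ A Q → ℤ} {g : A → ℤ} →
               (∀ x → f x ≡ g (proj₁ x)) → total (select Q? xs) f ≡ total xs (λ x → when (Q? x) (g x))
total-select Q? []       f≡g = refl
total-select Q? (x ∷ xs) f≡g with Q? x
... | yes q = cong₂ _+_ (f≡g (x , q)) (total-select Q? xs f≡g)
... | no  _ = trans (total-select Q? xs f≡g) (sym (ℤ.+-identityˡ _))

length-select : ∀ {Q : A → Set q} (Q? : Decidable Q) xs →
                ℤ.+ length (select Q? xs) ≡ total xs (λ x → when (Q? x) 1ℤ)
length-select Q? xs = trans (count (select Q? xs)) (total-select Q? xs λ _ → refl)
  where
  count : ∀ {b} {B : Set b} (ys : List B) → ℤ.+ length ys ≡ total ys (λ _ → 1ℤ)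
  count []       = refl
  count (y ∷ ys) = cong (1ℤ +_) (count ys)

-- Sums over tuples.

total-tuples : ∀ k (xs : List A) (f : Vec A (suc k) → ℤ) →
               total (tuples (suc k) xs) f ≡ total xs (λ x → total (tuples k xs) (λ t → f (x ∷ t)))
total-tuples k xs f = go xs (tuples k xs)
  where
  go : ∀ ys ts →
       total (cartesianProductWith _∷_ ys ts) f ≡ total ys (λ x → total ts (λ t → f (x ∷ t)))
  go []       ts = refl
  go (y ∷ ys) ts = trans (total-++ (map (y ∷_) ts) _ f)
    (cong₂ _+_ (total-map (y ∷_) ts f) (go ys ts))

total-tuples-map : ∀ (h : A → B) k xs (f : Vec B k → ℤ) →
                   total (tuples k (map h xs)) f ≡ total (tuples k xs) (f ∘ Vec.map h)
total-tuples-map h zero    xs f = refl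
total-tuples-map h (suc k) xs f = begin
  total (tuples (suc k) (map h xs)) f
    ≡⟨ total-tuples k (map h xs) f ⟩
  total (map h xs) (λ y → total (tuples k (map h xs)) (λ t → f (y ∷ t)))
    ≡⟨ total-map h xs _ ⟩
  total xs (λ x → total (tuples k (map h xs)) (λ t → f (h x ∷ t)))
    ≡⟨ total-cong xs (λ x → total-tuples-map h k xs (λ t → f (h x ∷ t))) ⟩
  total xs (λ x → total (tuples k xs) (λ t → f (h x ∷ Vec.map h t)))
    ≡⟨ total-tuples k xs (f ∘ Vec.map h) ⟨
  total (tuples (suc k) xs) (f ∘ Vec.map h) ∎
  where open ≡-Reasoning

-- A tuple with an entry outside `Q` contributes zero, so restricting the entries loses nothing. It
-- serves twice: for the faces above a given face, and for the non-empty faces.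
total-tuples-select : ∀ {Q : A → Set q} (Q? : Decidable Q) k xs (f : Vec A k → ℤ) →
                      (∀ t → ¬ All Q (toList t) → f t ≡ 0ℤ) →
                      total (tuples k (select Q? xs)) (f ∘ Vec.map proj₁) ≡ total (tuples k xs) f
total-tuples-select Q? zero    xs f f≡0 = refl
total-tuples-select {Q = Q} Q? (suc k) xs f f≡0 = begin
  total (tuples (suc k) (select Q? xs)) (f ∘ Vec.map proj₁)
    ≡⟨ total-tuples k (select Q? xs) _ ⟩
  total (select Q? xs) (λ x → total (tuples k (select Q? xs)) (λ t → f (proj₁ x ∷ Vec.map proj₁ t)))
    ≡⟨ total-select Q? xs (λ x → total-tuples-select Q? k xs (λ t → f (proj₁ x ∷ t))
         (λ t ¬qs → f≡0 (proj₁ x ∷ t) λ { (_ ∷ qs) → ¬qs qs })) ⟩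
  total xs (λ x → when (Q? x) (total (tuples k xs) (λ t → f (x ∷ t))))
    ≡⟨ total-cong xs (λ x → drop x (Q? x)) ⟩
  total xs (λ x → total (tuples k xs) (λ t → f (x ∷ t)))
    ≡⟨ total-tuples k xs f ⟨
  total (tuples (suc k) xs) f ∎
  where
  open ≡-Reasoning
  drop : ∀ x (q? : Dec (Q x)) → let s = total (tuples k xs) (λ t → f (x ∷ t)) in when q? s ≡ s
  drop x (yes _) = refl
  drop x (no ¬q) = sym (total-zero (tuples k xs) λ t → f≡0 (x ∷ t) λ { (q ∷ _) → ¬q q })

∈-tuples : ∀ {k} (t : Vec A k) → All (_∈ xs) (toList t) → t ∈ tuples k xs
∈-tuples []      []         = here refl
∈-tuples (x ∷ t) (x∈ ∷ t∈) = ∈-cartesianProductWith⁺ _∷_ x∈ (∈-tuples t t∈)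

-- Linear extension of integer functions to free modules.

eval : (A → ℤ) → FreeModule A → ℤ
eval φ u = total u λ t → proj₁ t * φ (proj₂ t)

eval-cong : ∀ {φ ψ : A → ℤ} u → (∀ x → φ x ≡ ψ x) → eval φ u ≡ eval ψ u
eval-cong u φ≡ψ = total-cong u λ t → cong (proj₁ t *_) (φ≡ψ (proj₂ t))

eval-gen : ∀ (φ : A → ℤ) x → eval φ (gen x) ≡ φ x
eval-gen φ x = trans (ℤ.+-identityʳ _) (ℤ.*-identityˡ (φ x))

eval-++ : ∀ (φ : A → ℤ) u v → eval φ (u ++ v) ≡ eval φ u + eval φ v
eval-++ φ u v = total-++ u v _

eval-⊙ : ∀ (φ : A → ℤ) c u → eval φ (c ⊙ u) ≡ c * eval φ u
eval-⊙ φ c u = trans (total-map _ u _)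
  (trans (total-cong u λ t → ℤ.*-assoc c (proj₁ t) _) (total-*ˡ u c _))

eval-∑ : ∀ (φ : A → ℤ) (xs : List B) (f : B → FreeModule A) →
         eval φ (∑-syntax xs f) ≡ total xs (λ x → eval φ (f x))
eval-∑ φ xs f = total-concatMap f xs _

eval-linear : ∀ (φ : B → ℤ) (g : A → FreeModule B) u →
              eval φ (linear g u) ≡ eval (λ x → eval φ (g x)) u
eval-linear φ g u = trans (eval-∑ φ u _) (total-cong u λ t → eval-⊙ φ (proj₁ t) (g (proj₂ t)))

coeffGenerator : ℕ → List ℕ → ℕ → List ℕ → ℤ
coeffGenerator k m i ω = if i ℕ.≡ᵇ k then coeffM ω m else 0ℤ

-- A composition is seen only through its list of parts, so that comparing monomial functions
-- reduces to equalities of lists of numbers.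
onGenerators : (ℕ → List ℕ → ℤ) → ℕ × Composition → ℤ
onGenerators φ (i , ω) = φ i (Composition.parts ω)

-- Each coefficient is the linear extension of its values on generators, so it suffices to compare
-- both sides under `eval (onGenerators φ)` for arbitrary `φ`.
coeff-eval : ∀ u k m → coeff u k m ≡ eval (onGenerators (coeffGenerator k m)) u
coeff-eval []                k m = refl
coeff-eval ((c , i , ω) ∷ u) k m =
  cong (c * coeffGenerator k m i (Composition.parts ω) +_) (coeff-eval u k m)

-- The involution is transposed: it moves into the functional, where it will meet the reversal built
-- into `flagTerm`.
eval-⋆ : ∀ φ u → eval (onGenerators φ) (u ⋆) ≡ eval (onGenerators (λ i ω → φ i (reverse ω))) u
eval-⋆ φ u = trans
  (eval-linear (onGenerators φ) (λ t → gen (proj₁ t , rev (proj₂ t))) u)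
  (eval-cong {ψ = onGenerators (λ i ω → φ i (reverse ω))} u λ t →
    eval-gen (onGenerators φ) (proj₁ t , rev (proj₂ t)))

-- Consecutive differences and increasing lists.

differences-map : ∀ (g h : A → ℕ) → (∀ x y → g y ∸ g x ≡ h y ∸ h x) →
                  ∀ xs → differences (map g xs) ≡ differences (map h xs)
differences-map g h e []           = refl
differences-map g h e (x ∷ [])     = refl
differences-map g h e (x ∷ y ∷ xs) = cong₂ _∷_ (e x y) (differences-map g h e (y ∷ xs))

-- A common offset cancels even for truncated subtraction, provided that the subtrahend `j` is not
-- cut off at zero.
∸-shift : ∀ {i j} k → i ≤ j → (k ∸ i) ∸ (j ∸ i) ≡ k ∸ j
∸-shift {i} {j} k i≤j = trans (ℕ.∸-+-assoc k i (j ∸ i)) (cong (k ∸_) (ℕ.m+[n∸m]≡n i≤j))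

map-toList-∷ʳ : ∀ (h : A → B) {k} (t : Vec A k) y →
                map h (toList t ++ y ∷ []) ≡ toList (Vec.map h t) ++ h y ∷ []
map-toList-∷ʳ h []      y = refl
map-toList-∷ʳ h (x ∷ t) y = cong (h x ∷_) (map-toList-∷ʳ h t y)

lookup-AllPairs : ∀ {R : Rel A r} → AllPairs R xs →
                  ∀ {i j} → i Fin.< j → R (lookup xs i) (lookup xs j)
lookup-AllPairs (rs ∷ _)  {zero}  {suc j} _         = All.lookup rs (∈-lookup j)
lookup-AllPairs (_ ∷ rss) {suc i} {suc j} (s≤s i<j) = lookup-AllPairs rss i<j

linked-init : ∀ {R : Rel A r} xs {y} → Linked R (xs ++ y ∷ []) → Linked R xs
linked-init []           l       = []
linked-init (x ∷ [])     l       = [-]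
linked-init (x ∷ z ∷ xs) (e ∷ l) = e ∷ linked-init (z ∷ xs) l

-- Every step raises the value by at least one. Applied to dimensions, this bounds the length of a
-- flag.
linked-<-bound : ∀ xs {x y} → Linked _<_ (x ∷ xs ++ y ∷ []) → x ℕ.+ length xs < y
linked-<-bound []       {x} (x<y ∷ _) = subst (_< _) (sym (ℕ.+-identityʳ x)) x<y
linked-<-bound (z ∷ xs) {x} (x<z ∷ l) = ℕ.≤-<-trans
  (subst (ℕ._≤ z ℕ.+ length xs) (sym (ℕ.+-suc x (length xs))) (ℕ.+-monoˡ-≤ (length xs) x<z))
  (linked-<-bound xs l)

linked-<-last : ∀ xs {y} → Linked _<_ (xs ++ y ∷ []) → All (_< y) xs
linked-<-last []           l         = []
linked-<-last (x ∷ [])     (x<y ∷ _) = x<y ∷ []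
linked-<-last (x ∷ z ∷ xs) (x<z ∷ l) with linked-<-last (z ∷ xs) l
... | z<y ∷ xs<y = ℕ.<-trans x<z z<y ∷ z<y ∷ xs<y

-- Chains in a graded poset.

module _ (Q : GradedPoset) where
  open GradedPoset Q using (Carrier; _≈_; poset; module Eq; elements; elements-complete; 0̂; 1̂; ρ)
    renaming (_<_ to _≺_)

  ≺-trans : ∀ {x y z} → x ≺ y → y ≺ z → x ≺ z
  ≺-trans {x} {y} {z} = NonStrictToStrict.<-trans _ _ (Poset.isPartialOrder poset) {x} {y} {z}

  -- Pigeonhole: two entries of a longer chain would be equivalent to the same listed element, but
  -- by transitivity they are related by `≺`, which excludes `≈`.
  length≤elements : ∀ {xs} → Linked _≺_ xs → length xs ≤ length elements
  length≤elements {xs} l = ℕ.≮⇒≥ λ shorter →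
    let (i , j , i<j , e) = Fin.pigeonhole shorter index
    in proj₂ (lookup-AllPairs (Linked.Linked⇒AllPairs (λ {x} {y} {z} → ≺-trans {x} {y} {z}) l) i<j)
         (Eq.trans (≈-element i)
           (subst (λ k → lookup elements k ≈ lookup xs j) (sym e) (Eq.sym (≈-element j))))
    where
    index : Fin (length xs) → Fin (length elements)
    index i = Any.index (elements-complete (lookup xs i))
    ≈-element : ∀ i → lookup xs i ≈ lookup elements (index i)
    ≈-element i = Any.lookup-index (elements-complete (lookup xs i))

  module _ (em : ExcludedMiddle 0ℓ) where
    open Ehrenborg em

    -- One formula covers both branches of `F₀`. If `0̂ ≈ 1̂`, a chain would compose to `0̂ ≺ 1̂`,
    -- so every term of the sum vanishes; otherwise the first summand is zero.
    eval-F₀ : ∀ (φ : List ℕ → ℤ) → eval (φ ∘ Composition.parts) (F₀ Q) ≡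
      when (em {0̂ ≈ 1̂}) (φ []) +
      total (upTo (length elements)) λ k → total (tuples k elements) λ t →
        when (em {IsChain Q t}) (φ (differences (map ρ (0̂ ∷ toList t ++ 1̂ ∷ []))))
    eval-F₀ φ with em {0̂ ≈ 1̂}
    ... | yes 0≈1 = trans (eval-gen (φ ∘ Composition.parts) ε) (sym (trans
      (cong (φ [] +_) (total-zero (upTo (length elements)) λ k →
        total-zero (tuples k elements) λ t → when-no em (no-chain t)))
      (ℤ.+-identityʳ _)))
      where
      bounds : ∀ xs {x y} → Linked _≺_ (x ∷ xs ++ y ∷ []) → x ≺ y
      bounds []       (x≺y ∷ _) = x≺y
      bounds (z ∷ xs) {x} {y} (x≺z ∷ l) = ≺-trans {x} {z} {y} x≺z (bounds xs l)
      no-chain : ∀ {k} (t : Vec Carrier k) → ¬ IsChain Q t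
      no-chain t c = proj₂ (bounds (toList t) c) 0≈1
    ... | no _ = begin
      eval φ′ (∑[ k ← upTo (length elements) ] ∑[ c ← chains Q k ] gen (chainType Q c))
        ≡⟨ eval-∑ φ′ (upTo (length elements)) _ ⟩
      total (upTo (length elements)) (λ k → eval φ′ (∑[ c ← chains Q k ] gen (chainType Q c)))
        ≡⟨ total-cong (upTo (length elements)) (λ k → trans (eval-∑ φ′ (chains Q k) _)
             (total-select (λ _ → em) (tuples k elements) (λ c → eval-gen φ′ (chainType Q c)))) ⟩
      _ ≡⟨ ℤ.+-identityˡ _ ⟨
      _ ∎
      where
      open ≡-Reasoning
      φ′ = φ ∘ Composition.parts

-- Faces, dimensions and flags of a polytope.

module _ (em : ExcludedMiddle 0ℓ) (ℝ : CompleteOrderedField) (P : Polytopes.Polytope em ℝ) where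
  open CompleteOrderedField ℝ using (+-identityʳ; zeroʳ)
    renaming (sym to ≈-sym; trans to ≈-trans)
  open LinearAlgebra em ℝ using (sum-zero)
  open Ehrenborg em using (F; F₀; IsChain)
  open Polytopes em ℝ
  open Polytope P
  open FaceLattice P

  rank : Face → ℕ
  rank F = affineRank (F ∋_)

  -- A single point is affinely independent. Hence `pred` in `dimension` really subtracts one on
  -- non-empty faces, whereas the empty face gets the same `dim` as a vertex.
  rank-nonEmpty : ∀ {F} → NonEmpty F → 1 ≤ rank F
  rank-nonEmpty {F} (x , x∈F) = contains-≤ (F ∋_) 1 ((λ _ → x) , (λ _ → x∈F) , independent)
    where
    independent : AffinelyIndependent {1} (λ _ → x)
    independent w w≈0 _ zero = ≈-trans (≈-sym (+-identityʳ (w zero))) w≈0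

  ⊆-nonEmpty : ∀ {F G} → F ⊆ G → NonEmpty F → NonEmpty G
  ⊆-nonEmpty F⊆G (x , x∈F) = x , F⊆G x x∈F

  dim-⊂ : ∀ {F G} → NonEmpty F → F ⊂ G → dim F < dim G
  dim-⊂ {F} {G} F≢∅ F⊂G = ℕ.∸-monoˡ-< (affineRank-⊂ F G F⊂G) (rank-nonEmpty {F} F≢∅)

  dim-≈ : ∀ {F G} → F ≈F G → dim F ≡ dim G
  dim-≈ {F} {G} (F⊆G , G⊆F) = cong pred
    (ℕ.≤-antisym (affineRank-mono (F ∋_) (G ∋_) F⊆G) (affineRank-mono (G ∋_) (F ∋_) G⊆F))

  linked-⊆ : ∀ F Gs → Linked _⊂_ (F ∷ Gs) → All (F ⊆_) Gs
  linked-⊆ F []       _               = []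
  linked-⊆ F (G ∷ Gs) ((F⊆G , _) ∷ l) = F⊆G ∷ All.map (λ G⊆H x → G⊆H x ∘ F⊆G x) (linked-⊆ G Gs l)

  linked-dim : ∀ F Gs → NonEmpty F → Linked _⊂_ (F ∷ Gs) → Linked _<_ (map dim (F ∷ Gs))
  linked-dim F []       F≢∅ _         = [-]
  linked-dim F (G ∷ Gs) F≢∅ (F⊂G ∷ l) =
    dim-⊂ {F} {G} F≢∅ F⊂G ∷ linked-dim G Gs (⊆-nonEmpty {F} {G} (proj₁ F⊂G) F≢∅) l

  -- Containment in `P` is automatic; the strict inequality of dimensions shows that the last face
  -- is not `P`. So the bound on flag types in `f` amounts to a last strict step to `improper`.
  linked-improper : ∀ F Gs → Linked _⊂_ (F ∷ Gs) → Linked _<_ (map dim (F ∷ Gs) ++ dimP P ∷ []) →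
                    Linked _⊂_ (F ∷ Gs ++ improper ∷ [])
  linked-improper F []       _         (F<P ∷ _) =
    (⊆-improper F , λ F≈P → ℕ.<-irrefl (dim-≈ {F} {improper} F≈P) F<P) ∷ [-]
  linked-improper F (G ∷ Gs) (F⊂G ∷ l) (_ ∷ l′)  = F⊂G ∷ linked-improper G Gs l l′

  -- This is both a chain with `k` inner elements from bottom to top of `interval F` and a chain of
  -- `k + 1` proper faces starting at `F`.
  Flag : ∀ {k} → Face → Vec Face k → Set
  Flag F t = Linked _⊂_ (F ∷ toList t ++ improper ∷ [])

  -- Listed upwards, as in the Ehrenborg function; the exponents in `f` are the reversed list.
  jumps : ∀ {k} → Face → Vec Face k → List ℕ
  jumps F t = differences (map dim (F ∷ toList t ++ improper ∷ []))

  flag-length : ∀ {k F} → NonEmpty F → (t : Vec Face k) → Flag F t → k < dimP P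
  flag-length {k} {F} F≢∅ t l = ℕ.≤-<-trans
    (subst (_≤ dim F ℕ.+ length (toList (Vec.map dim t)))
      (Vec.length-toList (Vec.map dim t)) (ℕ.m≤n+m _ (dim F)))
    (linked-<-bound (toList (Vec.map dim t))
      (subst (λ ds → Linked _<_ (dim F ∷ ds)) (map-toList-∷ʳ dim t improper)
        (linked-dim F (toList t ++ improper ∷ []) F≢∅ l)))

  -- The quasi-symmetric function of an interval `[F , P]`.

  nonEmptyFaces-nonEmpty : All NonEmpty nonEmptyFaces
  nonEmptyFaces-nonEmpty = All.map⁺ (All.universal proj₂ (select (λ _ → em) faces))

  -- All faces of a flag contain its non-empty first face `F`, so tuples with an empty entry are not
  -- flags.
  total-nonEmptyFaces : ∀ {k F} → NonEmpty F → (g : Vec Face k → ℤ) →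
                        (∀ t → ¬ Flag F t → g t ≡ 0ℤ) →
                        total (tuples k nonEmptyFaces) g ≡ total (tuples k faces) g
  total-nonEmptyFaces {k} {F} F≢∅ g g≡0 = trans
    (total-tuples-map proj₁ k (select (λ _ → em) faces) g)
    (total-tuples-select (λ _ → em) k faces g λ t ¬ne → g≡0 t λ l → ¬ne
      (All.map (λ {G} F⊆G → ⊆-nonEmpty {F} {G} F⊆G F≢∅) (All.++⁻ˡ (toList t) (linked-⊆ F _ l))))

  -- Three changes are made to the chain sum: elements of the interval become plain faces, `ρ`
  -- becomes `dim`, and the bound on the number of inner elements becomes `dimP`.
  eval-interval : ∀ {F} → NonEmpty F → (φ : List ℕ → ℤ) →
    eval (φ ∘ Composition.parts) (F₀ (interval F)) ≡
    when (em {F ≈F improper}) (φ []) + total (upTo (dimP P)) λ k →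
      total (tuples k nonEmptyFaces) λ t → when (em {Flag F t}) (φ (jumps F t))
  eval-interval {F} F≢∅ φ = trans (eval-F₀ (interval F) em φ)
   (cong (when (em {F ≈F improper}) (φ []) +_) (begin
    total (upTo (length elements)) chainTotal
      ≡⟨ total-cong (upTo (length elements)) chainTotal-faces ⟩
    total (upTo (length elements)) faceTotal
      -- Both bounds are large enough: a chain has distinct elements, and dimensions increase
      -- strictly along a flag.
      ≡⟨ total-applyUpTo id faceTotal (length elements) (dimP P)
           (λ k L≤k → trans (sym (chainTotal-faces k)) (total-zero (tuples k elements) λ t →
             when-no em λ c → ℕ.<-irrefl refl (ℕ.<-≤-trans (chain-length t c) L≤k)))
           (λ k n≤k → total-zero (tuples k faces) λ t →
             when-no em λ c → ℕ.<-irrefl refl (ℕ.<-≤-trans (flag-length F≢∅ t c) n≤k)) ⟩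
    total (upTo (dimP P)) faceTotal
      ≡⟨ total-cong (upTo (dimP P)) (λ k →
           total-nonEmptyFaces F≢∅ (faceTerm {k}) λ t → when-no em) ⟨
    _ ∎))
    where
    open ≡-Reasoning
    open GradedPoset (interval F) using (elements; 0̂; 1̂; ρ) renaming (Carrier to Above)
    faceTerm : ∀ {k} → Vec Face k → ℤ
    faceTerm t = when (em {Flag F t}) (φ (jumps F t))
    faceTotal : ℕ → ℤ
    faceTotal k = total (tuples k faces) faceTerm
    chainTerm : ∀ {k} → Vec Above k → ℤ
    chainTerm t = when (em {IsChain (interval F) t})
      (φ (differences (map ρ (0̂ ∷ toList t ++ 1̂ ∷ []))))
    chainTotal : ℕ → ℤ
    chainTotal k = total (tuples k elements) chainTerm
    chain-length : ∀ {k} (t : Vec Above k) → IsChain (interval F) t → k < length elements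
    chain-length t c = subst (λ n → suc n ≤ length elements) (Vec.length-toList t)
      (length≤elements (interval F) (linked-init (0̂ ∷ toList t) c))
    forget : ∀ {k} (t : Vec Above k) →
             map proj₁ (0̂ ∷ toList t ++ 1̂ ∷ []) ≡ F ∷ toList (Vec.map proj₁ t) ++ improper ∷ []
    forget t = cong (F ∷_) (map-toList-∷ʳ proj₁ t 1̂)
    ρ-differences : ∀ G H → ρ H ∸ ρ G ≡ dim (proj₁ H) ∸ dim (proj₁ G)
    -- Two offsets cancel in turn: the rank of `F` contained in `ρ`, and the one between `rank` and
    -- `dim`.
    ρ-differences (G , F⊆G) (H , F⊆H) = trans
      (∸-shift (rank H) (affineRank-mono (F ∋_) (G ∋_) F⊆G))
      (sym (∸-shift (rank H) (rank-nonEmpty {G} (⊆-nonEmpty {F} {G} F⊆G F≢∅))))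
    chainTerm-faces : ∀ {k} (t : Vec Above k) → chainTerm t ≡ faceTerm (Vec.map proj₁ t)
    chainTerm-faces t = when-cong em em
      (λ c → subst (Linked _⊂_) (forget t) (Linked.map⁺ c))
      (λ l → Linked.map⁻ (subst (Linked _⊂_) (sym (forget t)) l))
      (λ _ → cong φ (trans (differences-map ρ (dim ∘ proj₁) ρ-differences chain)
        (cong differences (trans (List.map-∘ chain) (cong (map dim) (forget t))))))
      where chain = 0̂ ∷ toList t ++ 1̂ ∷ []
    chainTotal-faces : ∀ k → chainTotal k ≡ faceTotal k
    chainTotal-faces k = trans (total-cong (tuples k elements) chainTerm-faces)
      (total-tuples-select (λ _ → em) k faces faceTerm λ t ¬⊆ → when-no em λ l →
        ¬⊆ (All.++⁻ˡ (toList t) (linked-⊆ F _ l)))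

  -- Flags and their dimension types.

  isFlagType? : ∀ {k} → Decidable (IsFlagType P {k})
  isFlagType? a = Linked.linked? ℕ._<?_ (toList a ++ dimP P ∷ [])

  flag-type : ∀ {k} F (t : Vec Face k) → NonEmpty F → Flag F t → IsFlagType P (Vec.map dim (F ∷ t))
  flag-type F t F≢∅ l = subst (λ ds → Linked _<_ (dim F ∷ ds)) (map-toList-∷ʳ dim t improper)
    (linked-dim F (toList t ++ improper ∷ []) F≢∅ l)

  type-flag : ∀ {k} F (t : Vec Face k) →
              Linked _⊂_ (F ∷ toList t) → IsFlagType P (Vec.map dim (F ∷ t)) → Flag F t
  type-flag F t l l′ = linked-improper F (toList t) l
    (subst (λ ds → Linked _<_ (dim F ∷ ds ++ dimP P ∷ [])) (Vec.toList-map dim t) l′)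

  module _ (φ : ℕ → List ℕ → ℤ) where

    flagTypeTerm : ∀ {k} → Vec ℕ (suc k) → ℤ
    flagTypeTerm a = φ (Vec.head a) (differences (toList a ++ dimP P ∷ []))

    flagValue : ∀ {k} → Face → Vec Face k → ℤ
    flagValue F t = when (em {Flag F t}) (φ (dim F) (jumps F t))

    -- The summand of a double sum over types `a` and tuples `c`, with both conditions as weights so
    -- that the order of summation can be exchanged.
    typedTerm : ∀ {k} → Vec ℕ (suc k) → Vec Face (suc k) → ℤ
    typedTerm a c = when (isFlagType? a)
      (when (em {Linked _⊂_ (toList c) × Vec.map dim c ≡ a}) (flagTypeTerm a))

    -- A tuple can match only the type formed by its own dimensions. It is strictly increasing along
    -- `⊂` with an admissible type exactly when it extends to a flag ending in `P`.
    total-types : ∀ {k} F (t : Vec Face k) → NonEmpty F →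
      total (tuples (suc k) (upTo (dimP P))) (λ a → typedTerm a (F ∷ t)) ≡ flagValue F t
    total-types {k} F t F≢∅ with em {Flag F t}
    ... | yes l = trans (total-cong (tuples (suc k) (upTo (dimP P))) same)
          (total-single (λ a → em {ds ≡ a})
            (AllPairs.map (λ a≢b (e , e′) → a≢b (trans (sym e) e′))
              (tuples-unique (Unique.upTo⁺ (dimP P)) (suc k)))
            (∈-tuples ds (All.map ∈-upTo⁺ (linked-<-last (toList ds) ds↗)))
            λ { _ refl → cong (φ (dim F) ∘ differences ∘ (dim F ∷_))
                           (sym (map-toList-∷ʳ dim t improper)) })
      where
      ds = Vec.map dim (F ∷ t)
      ds↗ = flag-type F t F≢∅ l
      same : ∀ a → typedTerm a (F ∷ t) ≡ when (em {ds ≡ a}) (flagTypeTerm a)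
      same a with em {ds ≡ a}
      ... | yes refl = trans (when-yes (isFlagType? a) ds↗)
                             (when-yes em (linked-init (F ∷ toList t) l , refl))
      ... | no  ds≢a = trans (cong (when (isFlagType? a)) (when-no em (ds≢a ∘ proj₂)))
                             (when-0 (isFlagType? a))
    ... | no ¬l = total-zero (tuples (suc k) (upTo (dimP P))) none
      where
      none : ∀ a → typedTerm a (F ∷ t) ≡ 0ℤ
      none a with isFlagType? a
      ... | yes a↗ = when-no em λ { (l , refl) → ¬l (type-flag F t l a↗) }
      ... | no  _  = refl

    -- Evaluation of the generalized `f`-polynomial.

    reversed : ℕ × Composition → ℤ
    reversed = onGenerators λ i ω → φ i (reverse ω)

    eval-flagTerm : ∀ {k} (a : Σ (Vec ℕ (suc k)) (IsFlagType P)) →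
      eval reversed (flagTerm P a) ≡ ℤ.+ flagNumber P (proj₁ a) * flagTypeTerm (proj₁ a)
    eval-flagTerm (a , a↗) = trans
      (eval-⊙ reversed (ℤ.+ flagNumber P a) (gen (Vec.head a , rev (gaps a↗))))
      (cong (ℤ.+ flagNumber P a *_) (trans (eval-gen reversed (Vec.head a , rev (gaps a↗)))
        -- The reversal in `flagTerm` cancels against the one coming from `⋆`.
        (cong (φ (Vec.head a)) (List.reverse-involutive (differences (toList a ++ dimP P ∷ []))))))

    -- Each flag number is written as a sum of ones over tuples of faces. After exchanging the sums,
    -- every flag meets exactly one type.
    total-flagTypes : ∀ k →
      total (flagTypes P (suc k)) (λ a → eval reversed (flagTerm P a)) ≡
      total nonEmptyFaces (λ F → total (tuples k nonEmptyFaces) (flagValue F))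
    total-flagTypes k = begin
      total (flagTypes P (suc k)) (λ a → eval reversed (flagTerm P a))
        ≡⟨ total-select isFlagType? as eval-flagTerm ⟩
      total as (λ a → when (isFlagType? a) (ℤ.+ flagNumber P a * flagTypeTerm a))
        ≡⟨ total-cong as expand ⟩
      total as (λ a → total cs λ c → typedTerm a c)
        ≡⟨ total-swap as cs typedTerm ⟩
      total cs (λ c → total as λ a → typedTerm a c)
        ≡⟨ total-tuples k nonEmptyFaces (λ c → total as λ a → typedTerm a c) ⟩
      total nonEmptyFaces (λ F → total (tuples k nonEmptyFaces) λ t → total as λ a → typedTerm a (F ∷ t))
        ≡⟨ total-congAll (All.map (λ {F} F≢∅ → total-cong (tuples k nonEmptyFaces) λ t →
             total-types F t F≢∅) nonEmptyFaces-nonEmpty) ⟩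
      total nonEmptyFaces (λ F → total (tuples k nonEmptyFaces) (flagValue F)) ∎
      where
      open ≡-Reasoning
      as = tuples (suc k) (upTo (dimP P))
      cs = tuples (suc k) nonEmptyFaces
      expand : ∀ a → when (isFlagType? a) (ℤ.+ flagNumber P a * flagTypeTerm a) ≡ total cs (typedTerm a)
      expand a = trans (cong (when (isFlagType? a)) (begin
        ℤ.+ flagNumber P a * flagTypeTerm a
          ≡⟨ cong (_* flagTypeTerm a) (length-select hasType? cs) ⟩
        total cs (λ c → when (hasType? c) 1ℤ) * flagTypeTerm a
          ≡⟨ total-*ʳ cs _ (flagTypeTerm a) ⟩
        total cs (λ c → when (hasType? c) 1ℤ * flagTypeTerm a)
          ≡⟨ total-cong cs (λ c → trans (when-*ʳ (hasType? c) 1ℤ (flagTypeTerm a))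
               (cong (when (hasType? c)) (ℤ.*-identityˡ (flagTypeTerm a)))) ⟩
        total cs (λ c → when (hasType? c) (flagTypeTerm a)) ∎))
        (sym (total-when cs (isFlagType? a) _))
        where
        hasType? : Decidable λ c → Linked _⊂_ (toList c) × Vec.map dim c ≡ a
        hasType? c = em

    -- The contribution of the non-empty flags to either side; `k` counts the proper faces after the
    -- first.
    flagTotal : ℤ
    flagTotal = total (upTo (dimP P)) λ k → total nonEmptyFaces λ F →
      total (tuples k nonEmptyFaces) (flagValue F)

    eval-f : eval reversed (f P) ≡ φ (dimP P) [] + flagTotal
    eval-f = begin
      eval reversed (f P)
        ≡⟨ eval-++ reversed (gen (dimP P , ε)) (∑[ k ← upTo (dimP P) ] typeSum k) ⟩
      eval reversed (gen (dimP P , ε)) + eval reversed (∑[ k ← upTo (dimP P) ] typeSum k)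
        ≡⟨ cong₂ _+_ (eval-gen reversed (dimP P , ε)) (eval-∑ reversed (upTo (dimP P)) typeSum) ⟩
      φ (dimP P) [] + total (upTo (dimP P)) (λ k → eval reversed (typeSum k))
        ≡⟨ cong (φ (dimP P) [] +_) (total-cong (upTo (dimP P)) λ k →
             trans (eval-∑ reversed (flagTypes P (suc k)) (flagTerm P)) (total-flagTypes k)) ⟩
      φ (dimP P) [] + flagTotal ∎
      where
      open ≡-Reasoning
      typeSum : ℕ → QSym[α]
      typeSum k = ∑[ a ← flagTypes P (suc k) ] flagTerm P a

    -- Evaluation of the Ehrenborg function of `lα`.

    total-improper :
      total nonEmptyFaces (λ F → when (em {F ≈F improper}) (φ (dim F) [])) ≡ φ (dimP P) []
    -- Listed faces are pairwise distinct up to `≈F`, so exactly one of them is `P`; it is non-empty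
    -- because there is at least one generator.
    total-improper = total-single (λ F → em {F ≈F improper})
      (AllPairs.map⁺ (AllPairs.map (λ {(F , _)} {(G , _)} F≉G ((F⊆P , P⊆F) , (G⊆P , P⊆G)) →
          F≉G ((λ x → P⊆G x ∘ F⊆P x) , (λ x → P⊆F x ∘ G⊆P x)))
        (select-AllPairs (λ _ → em) faces-unique)))
      (Any.map⁺ (Any.map (λ (P⊆F , F⊆P) → F⊆P , P⊆F) (select-Any (λ _ → em)
        (λ {F} (P⊆F , _) → ⊆-nonEmpty {improper} {F} P⊆F improper-nonEmpty)
        (faces-complete improper))))
      (λ F F≈P → cong (λ d → φ d []) (dim-≈ {F} {improper} F≈P))
      where
      improper-nonEmpty : NonEmpty improper
      improper-nonEmpty =
        generators zero , generator-∈P zero , sum-zero λ j → zeroʳ (generators zero j)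

    eval-F-lα : eval (onGenerators φ) (F (lα (gen P))) ≡ φ (dimP P) [] + flagTotal
    eval-F-lα = begin
      eval (onGenerators φ) (F (lα (gen P)))
        ≡⟨ eval-linear (onGenerators φ) α·F₀ (lα (gen P)) ⟩
      eval φ∘F (lα (gen P))
        ≡⟨ trans (eval-linear φ∘F l₀ (gen P)) (eval-gen (eval φ∘F ∘ l₀) P) ⟩
      eval φ∘F (l₀ P)
        ≡⟨ trans (eval-∑ φ∘F nonEmptyFaces (λ F → gen (dim F , interval F)))
             (total-cong nonEmptyFaces λ F → eval-gen φ∘F (dim F , interval F)) ⟩
      total nonEmptyFaces (λ F → φ∘F (dim F , interval F))
        ≡⟨ total-congAll (All.map (λ {F} F≢∅ →
             trans (φ∘F-≡ (dim F) (interval F)) (eval-interval {F} F≢∅ (φ (dim F))))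
             nonEmptyFaces-nonEmpty) ⟩
      total nonEmptyFaces (λ F →
        when (em {F ≈F improper}) (φ (dim F) []) + total (upTo (dimP P)) (flagValues F))
        ≡⟨ total-+ nonEmptyFaces _ _ ⟩
      total nonEmptyFaces (λ F → when (em {F ≈F improper}) (φ (dim F) [])) +
      total nonEmptyFaces (λ F → total (upTo (dimP P)) (flagValues F))
        -- Flags grouped first by their least face are regrouped first by length, as in `f`.
        ≡⟨ cong₂ _+_ total-improper (total-swap nonEmptyFaces (upTo (dimP P)) flagValues) ⟩
      φ (dimP P) [] + flagTotal ∎
      where
      open ≡-Reasoning
      α·F₀ : ℕ × GradedPoset → QSym[α]
      α·F₀ (i , Q) = α^ i · F₀ Q
      φ∘F : ℕ × GradedPoset → ℤ
      φ∘F = eval (onGenerators φ) ∘ α·F₀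
      φ∘F-≡ : ∀ i Q → φ∘F (i , Q) ≡ eval (φ i ∘ Composition.parts) (F₀ Q)
      φ∘F-≡ i Q = trans (eval-linear (onGenerators φ) (λ ω → gen (i , ω)) (F₀ Q))
        (eval-cong {ψ = φ i ∘ Composition.parts} (F₀ Q) λ ω → eval-gen (onGenerators φ) (i , ω))
      flagValues : Face → ℕ → ℤ
      flagValues F k = total (tuples k nonEmptyFaces) (flagValue F)

-- Comparison of coefficients.

proposition39 : (em : ExcludedMiddle 0ℓ) (ℝ : CompleteOrderedField) (P : Polytopes.Polytope em ℝ) →
    Ehrenborg.F em (Polytopes.lα em ℝ (gen P)) ≈Q (Polytopes.f em ℝ P) ⋆
proposition39 em ℝ P k m = begin
  coeff Fl k m              ≡⟨ coeff-eval Fl k m ⟩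
  eval (onGenerators φ) Fl  ≡⟨ eval-F-lα em ℝ P φ ⟩
  -- The common value of both sides is `φ (dimP P) []` plus `flagTotal`.
  _                         ≡⟨ eval-f em ℝ P φ ⟨
  _                         ≡⟨ eval-⋆ φ (Polytopes.f em ℝ P) ⟨
  _                         ≡⟨ coeff-eval f⋆ k m ⟨
  coeff f⋆ k m              ∎
  where
  open ≡-Reasoning
  φ = coeffGenerator k m
  Fl = Ehrenborg.F em (Polytopes.lα em ℝ (gen P))
  f⋆ = Polytopes.f em ℝ P ⋆
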